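{- There exists an absolute constant $c>0$ such that for every positive integer $k$ there exist a planar graph $G=(V,E,\ell)$ with nonnegative edge lengths (namely, the $k\times k$ grid with suitable edge lengths) and a set $R\subseteq V$ of $k$ terminals with the following property: every planar graph $H$ with nonnegative edge lengths such that $R\subseteq V(H)$ and $d_H(u,v)=d_G(u,v)$ for all $u,v\in R$ has at least $ck^2$ vertices. In particular, $f^*(k,\mathrm{Planar})\ge ck^2$, where $\mathrm{Planar}$ is the family of all planar graphs.
   Context: $d_H$ denotes shortest-path distance in a graph $H$ with respect to its edge lengths. Given a graph $G=(V,E,\ell)$ and terminals $R\subseteq V$, a distance-preserving minor of $G$ with respect to $R$ is a graph $G'$ with edge lengths $\ell'$ (which may differ from $\ell$) such that $G'$ is a minor of $G$ in which the terminals survive (terminals are never deleted and no two terminals are merged; a terminal may be merged with non-terminals by contraction and the resulting vertex is identified with that terminal), so $R\subseteq V(G')$, and $d_{G'}(u,v)=d_G(u,v)$ for all $u,v\in R$. For a family $\mathcal{F}$ of graphs, $f^*(k,\mathcal{F})$ is the minimum number such that every graph in $\mathcal{F}$, with any nonnegative edge lengths and any $k$ terminals, admits a distance-preserving minor with at most $f^*(k,\mathcal{F})$ vertices.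
   Formalization: Edge lengths, in particular those of the arbitrary planar graph H, are rational rather than real nonnegative numbers; the immediate consequence for f*(k, Planar) is not stated separately. -}

module Defs where

open import Data.Nat as ℕ using (ℕ; zero; suc; _≤ᵇ_)
open import Data.Fin as Fin using (Fin; toℕ)
open import Data.Bool as Bool using (Bool; true; false; _∧_; _∨_; not; if_then_else_)
open import Data.List using (List; []; _∷_; concatMap; allFin; upTo; length; filterᵇ)
open import Data.Bool.ListAction using (all; any)
open import Data.Product using (Σ; _×_; _,_; proj₁; proj₂; ∃)
open import Data.Sum using (_⊎_)
open import Data.Rational using (ℚ; 0ℚ; _≤_; _+_; _/_)
open import Data.Integer using (+_)
open import Relation.Nullary.Decidable using (⌊_⌋)
open import Relation.Binary.PropositionalEquality using (_≡_)
open import Function using (_∘_)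
open import Function.Definitions using (Injective)

-- Graphs with edge lengths over a vertex type V.
-- Edges are indexed by Fin m; each edge has two ends and a length in ℚ.
-- (Parallel edges / loops are allowed; they affect neither distances
-- nor planarity.)

record Graph (V : Set) : Set where
  field
    m    : ℕ
    ends : Fin m → V × V
    len  : Fin m → ℚ
open Graph public

ℕ→ℚ : ℕ → ℚ
ℕ→ℚ n = (+ n) / 1

NonNeg : ∀ {V} → Graph V → Set
NonNeg G = ∀ e → 0ℚ ≤ len G e

Dart : ∀ {V} → Graph V → Set
Dart G = Fin (m G) × Bool

tail : ∀ {V} (G : Graph V) → Dart G → V
tail G (e , false) = proj₁ (ends G e)
tail G (e , true)  = proj₂ (ends G e)

head : ∀ {V} (G : Graph V) → Dart G → V
head G (e , false) = proj₂ (ends G e)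
head G (e , true)  = proj₁ (ends G e)

flip : ∀ {V} (G : Graph V) → Dart G → Dart G
flip G (e , b) = (e , not b)

darts : ∀ {V} (G : Graph V) → List (Dart G)
darts G = concatMap (λ e → (e , false) ∷ (e , true) ∷ []) (allFin (m G))

_==ᵈ_ : ∀ {V} {G : Graph V} → Dart G → Dart G → Bool
(e , b) ==ᵈ (e' , b') = ⌊ e Fin.≟ e' ⌋ ∧ ⌊ b Bool.≟ b' ⌋

key : ∀ {V} {G : Graph V} → Dart G → ℕ
key (e , b) = 2 ℕ.* toℕ e ℕ.+ (if b then 1 else 0)

iter : ∀ {A : Set} → ℕ → (A → A) → A → A
iter zero    f x = x
iter (suc t) f x = f (iter t f x)

countᵇ : ∀ {A : Set} → (A → Bool) → List A → ℕ
countᵇ p xs = length (filterᵇ p xs)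

-- number of orbits of a permutation f of the darts
-- (= number of darts that are key-minimal in their f-orbit)
orbitCount : ∀ {V} (G : Graph V) → (Dart G → Dart G) → ℕ
orbitCount G f =
  countᵇ (λ d → all (λ t → key {G = G} d ≤ᵇ key {G = G} (iter t f d)) (upTo (2 ℕ.* m G)))
         (darts G)

close : ∀ {V} (G : Graph V) → (Dart G → Dart G) → ℕ → (Dart G → Bool) → (Dart G → Bool)
close G σ zero    S = S
close G σ (suc k) S = close G σ k
  (λ d → S d ∨ any (λ d' → S d' ∧ ((_==ᵈ_ {G = G} (σ d') d) ∨ (_==ᵈ_ {G = G} (flip G d') d))) (darts G))

compOf : ∀ {V} (G : Graph V) → (Dart G → Dart G) → Dart G → Dart G → Bool
compOf G σ d = close G σ (2 ℕ.* m G) (λ d' → _==ᵈ_ {G = G} d' d)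

-- number of connected components of the map (components containing an edge)
compCount : ∀ {V} (G : Graph V) → (Dart G → Dart G) → ℕ
compCount G σ =
  countᵇ (λ d → all (λ d' → not (compOf G σ d d') ∨ (key {G = G} d ≤ᵇ key {G = G} d')) (darts G))
         (darts G)

-- Combinatorial embeddings (rotation systems) and planarity.
-- A rotation system is a permutation σ of the darts whose cycles are
-- exactly the sets of darts with a common tail (the cyclic order of the
-- darts around each vertex).

RotationSystem : ∀ {V} (G : Graph V) → (Dart G → Dart G) → Set
RotationSystem G σ =
  Injective _≡_ _≡_ σ
  × (∀ d → tail G (σ d) ≡ tail G d)
  × (∀ d d' → tail G d ≡ tail G d' → ∃ λ t → iter t σ d ≡ d')

-- G is planar iff it has a rotation system of Euler genus 0, i.e.
-- (#vertex-orbits) − (#edges) + (#faces) = 2 · (#components),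
-- where faces are the orbits of the face-tracing permutation σ ∘ α.
-- (Isolated vertices are irrelevant for planarity and are not counted.)
Planar : ∀ {V} → Graph V → Set
Planar G = ∃ λ (σ : Dart G → Dart G) →
  RotationSystem G σ
  × (orbitCount G σ ℕ.+ orbitCount G (σ ∘ flip G) ≡ m G ℕ.+ 2 ℕ.* compCount G σ)

data Walk {V} (G : Graph V) : V → V → Set where
  nil  : ∀ {v} → Walk G v v
  cons : ∀ {w} (d : Dart G) → Walk G (head G d) w → Walk G (tail G d) w

walkLen : ∀ {V} {G : Graph V} {u v} → Walk G u v → ℚ
walkLen nil = 0ℚ
walkLen {G = G} (cons d p) = len G (proj₁ d) + walkLen p

IsDist : ∀ {V} (G : Graph V) → V → V → ℚ → Set
IsDist G u v x = (∃ λ (p : Walk G u v) → walkLen p ≡ x) × (∀ (p : Walk G u v) → x ≤ walkLen p)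

-- d_G(u,v) = d_H(u',v')  (including the case where both are ∞)
SameDist : ∀ {V W} (G : Graph V) → V → V → (H : Graph W) → W → W → Set
SameDist G u v H u' v' = ∀ x → (IsDist G u v x → IsDist H u' v' x) × (IsDist H u' v' x → IsDist G u v x)

Adj1 : ∀ {k} → Fin k → Fin k → Set
Adj1 i i' = (suc (toℕ i) ≡ toℕ i') ⊎ (suc (toℕ i') ≡ toℕ i)

GridAdj : ∀ {k} → Fin k × Fin k → Fin k × Fin k → Set
GridAdj (i , j) (i' , j') = (i ≡ i' × Adj1 j j') ⊎ (j ≡ j' × Adj1 i i')

IsGrid : ∀ k → Graph (Fin k × Fin k) → Set
IsGrid k G =
  (∀ e → GridAdj (proj₁ (ends G e)) (proj₂ (ends G e)))
  × (∀ x y → GridAdj x y → ∃ λ e → (ends G e ≡ (x , y)) ⊎ (ends G e ≡ (y , x)))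

{-# OPTIONS --safe #-}
-- The proof counts parameters instead of following shortest paths through the plane. The distances
-- realised by a graph H on n vertices only depend on its lightest non-loop edge between each pair
-- of adjacent vertices, and if H is planar there are at most 3n of these. The grid has lengths for
-- which differences of terminal distances are the N powers b^0, …, b^(N-1), N ~ k²/4: the path from
-- (i , 0) to (0 , j) runs along row i and then up column j, so passing from j to j + 1 adds exactly
-- the length of one edge of row i. Hence each of the b^N combinations Σ yₚ bᵖ with digits yₚ < b is
-- determined by the edge multiplicities, at most N b n each, of unions of shortest walks of H. So
-- b^N ≤ (N b n + 1)^(6n), and b = N yields n = Ω(N).
--
-- For sparsity, delete an edge by turning its two darts into fixed points of the rotation system.
-- This multiplies the vertex permutation and the face permutation by a transposition each, from
-- which one sees that the genus does not increase.
module Submission where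

open import Defs
open import Data.Nat using (ℕ; _*_; _≤_)
open import Data.Fin using (Fin)
open import Data.Product using (Σ; _×_)
open import Data.Rational using (ℚ; 0ℚ) renaming (_<_ to _<ℚ_; _≤_ to _≤ℚ_; _*_ to _*ℚ_)
open import Relation.Binary.PropositionalEquality using (_≡_)
open import Function.Definitions using (Injective)

open import Level using (0ℓ)
open import Data.Nat as ℕ using (zero; suc; pred; _<_; z≤n; s≤s; _+_; _∸_; _⊔_; _^_; _/_; _%_; _≤ᵇ_)
import Data.Nat.Properties as ℕₚ
import Data.Nat.DivMod as DivMod
open import Data.Nat.Solver using (module +-*-Solver)
open import Data.Integer as ℤ using ()
import Data.Integer.Properties as ℤₚ
import Data.Rational as ℚ
import Data.Rational.Properties as ℚₚ
open import Data.Rational.Unnormalised as ℚᵘ using (mkℚᵘ; *≡*; *≤*)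
import Data.Rational.Unnormalised.Properties as ℚᵘₚ
open import Data.Fin as Fin
  using (zero; suc; toℕ; inject₁; fromℕ; fromℕ<; punchOut; punchIn; splitAt; _↑ˡ_; _↑ʳ_; combine; remQuot; funToFin; finToFun)
import Data.Fin.Properties as Finₚ
open import Data.Bool using (Bool; true; false; not; T; _∧_; _∨_; if_then_else_)
import Data.Bool.Properties as Boolₚ
open import Data.Bool.ListAction using (all; any)
open import Data.Maybe as Maybe using (Maybe; just; nothing; fromMaybe; _<∣>_)
import Data.Maybe.Properties as Maybeₚ
open import Data.Product using (_,_; proj₁; proj₂; ∃; swap; uncurry)
import Data.Product.Properties as Productₚ
open import Data.Product.Function.NonDependent.Propositional using (_×-↔_)
open import Data.Product.Relation.Binary.Lex.NonStrict using (×-totalOrder)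
open import Data.Sum using (_⊎_; inj₁; inj₂)
import Data.Sum.Properties as Sumₚ
open import Data.Sum.Function.Propositional using (_⊎-↔_)
open import Data.Empty using (⊥; ⊥-elim)
open import Data.List using (List; []; _∷_; _++_; length; map; allFin; lookup; filter; filterᵇ; concatMap; upTo)
import Data.List.Properties as Listₚ
import Data.List.Extrema as Extrema
open import Data.List.Relation.Unary.Any as Any using (here; there)
import Data.List.Relation.Unary.Any.Properties as Anyₚ
open import Data.List.Relation.Unary.All as All using ([]; _∷_)
import Data.List.Relation.Unary.All.Properties as Allₚ
open import Data.List.Relation.Unary.AllPairs as AllPairs using ([]; _∷_)
import Data.List.Relation.Unary.AllPairs.Properties as AllPairsₚ
open import Data.List.Relation.Unary.Unique.Propositional using (Unique)
import Data.List.Relation.Unary.Unique.Propositional.Properties as Uniqueₚ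
open import Data.List.Membership.Propositional using (_∈_; find; lose)
open import Data.List.Membership.Propositional.Properties
  using (∈-map⁺; ∈-map⁻; ∈-allFin; ∈-++⁺ˡ; ∈-++⁺ʳ; ∈-++⁻; ∈-concatMap⁺; ∈-filter⁺; ∈-filter⁻; ∈-upTo⁺; ∈-lookup)
import Data.List.Membership.DecPropositional as DecMembership
open import Relation.Nullary using (¬_; Dec; yes; no; contradiction; ¬?)
open import Relation.Nullary.Decidable using (T?; ⌊_⌋; toWitness; fromWitness; _⊎-dec_; _×-dec_)
open import Relation.Unary using (Decidable)
open import Relation.Binary.Core using (Rel)
open import Relation.Binary.Definitions using (DecidableEquality)
open import Relation.Binary.Bundles using (TotalOrder)
open import Relation.Binary.PropositionalEquality
  using (_≢_; refl; sym; trans; cong; cong₂; subst; subst₂; isEquivalence; module ≡-Reasoning)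
open import Relation.Binary.Construct.Closure.Equivalence as Eq using (EqClosure)
open import Function using (_∘_; id; _↔_; Inverse; Injection; Equivalence)
open import Function.Properties.Inverse using (↔-refl; ↔-sym; ↔-trans; ↔⇒↣)
open import Algebra.Properties.CommutativeMonoid.Sum ℚₚ.+-0-commutativeMonoid
  using (sum; ∑-distrib-+; sum-cong-≗; sum-replicate-zero)
open import Algebra.Properties.Monoid.Mult ℚₚ.+-0-monoid
  using (×-homo-+; ×-homo-1) renaming (_×_ to _·_)
open import Algebra.Properties.CommutativeMonoid.Sum ℕₚ.+-0-commutativeMonoid
  using () renaming (sum to sumℕ; ∑-distrib-+ to sumℕ-distrib-+; sum-cong-≗ to sumℕ-cong)

-- Counting the classes of a finite equivalence relation

-- The lengths of `H` are arbitrary nonnegative rationals, so no bound can come from their size.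
-- What is bounded is the number of multiplicity vectors: in a fixed graph the length of a multiset
-- of edges is a linear function of its multiplicities, so distinct lengths need distinct vectors.
-- Each power of `b` is a difference of two distances, so two vectors are recorded, one for the
-- minuends and one for the subtrahends; hence the exponent is twice the edge bound `3n`. Without
-- planarity that bound would be quadratic in `n`, and the same count would give only `n = Ω(k)`.
--
-- Unwanted edges are not removed but kept as isolated edges. All maps then live on the same darts
-- with the same `m`, and their orbits and components can be compared directly. Euler's formula is
-- used in the form of two inequalities, `V + F ≤ m + 2C` for every map and the converse for planar
-- ones, so each count is needed only in the direction in which an injection is at hand.

≡-invariant : ∀ {A B : Set} {R : Rel A 0ℓ} (f : A → B) →
  (∀ {x y} → R x y → f x ≡ f y) → ∀ {x y} → EqClosure R x y → f x ≡ f y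
≡-invariant f = Eq.gfold isEquivalence f

step : ∀ {A : Set} {R : Rel A 0ℓ} {x y} → R x y → EqClosure R x y
step = Eq.return

reverse : ∀ {A : Set} {R : Rel A 0ℓ} {x y} → EqClosure R x y → EqClosure R y x
reverse = Eq.symmetric _

infixr 5 _▸_
_▸_ : ∀ {A : Set} {R : Rel A 0ℓ} {x y z} → EqClosure R x y → EqClosure R y z → EqClosure R x z
_▸_ = Eq.transitive _

extend : ∀ {A : Set} {R S : Rel A 0ℓ} →
  (∀ {x y} → R x y → EqClosure S x y) → ∀ {x y} → EqClosure R x y → EqClosure S x y
extend = Eq.fold (Eq.isEquivalence _)

stay : ∀ {A : Set} {R : Rel A 0ℓ} {x y} → x ≡ y → EqClosure R x y
stay refl = Eq.reflexive _

Join : ∀ {A : Set} → Rel A 0ℓ → A → A → Rel A 0ℓ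
Join R a b x y = R x y ⊎ (x ≡ a × y ≡ b)

-- A finite quotient kept as data: `EqClosure R` is the kernel of `cls`, hence decidable, and `rep`
-- is a section. Numbers of classes are compared through injections between the sets `Fin N`.
record Classes {A : Set} (R : Rel A 0ℓ) (N : ℕ) : Set where
  field
    cls      : A → Fin N
    rep      : Fin N → A
    cls-rep  : ∀ c → cls (rep c) ≡ c
    sound    : ∀ {x y} → R x y → cls x ≡ cls y
    complete : ∀ {x y} → cls x ≡ cls y → EqClosure R x y

  sound* : ∀ {x y} → EqClosure R x y → cls x ≡ cls y
  sound* = ≡-invariant cls sound

open Classes

module _ {A : Set} {R S : Rel A 0ℓ} {M N : ℕ} (P : Classes R M) (Q : Classes S N) where

  refinement-≤ : (∀ {x y} → R x y → EqClosure S x y) → N ≤ M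
  refinement-≤ R⊆S = Finₚ.injective⇒≤ {f = cls P ∘ rep Q} inj
    where
    inj : Injective _≡_ _≡_ (cls P ∘ rep Q)
    inj {c} {c'} e = trans (sym (cls-rep Q c))
      (trans (sound* Q (extend R⊆S (complete P e))) (cls-rep Q c'))

  -- The coarser class of `a` contains `b` too. With `a` as its representative, the finer class of
  -- `b` is missed by all representatives, and the extra index `zero` is sent there.
  refinement-< : ∀ {a b} → (∀ {x y} → R x y → EqClosure S x y) →
    EqClosure S a b → ¬ EqClosure R a b → suc N ≤ M
  refinement-< {a} {b} R⊆S aSb ¬aRb = Finₚ.injective⇒≤ {f = f} inj
    where
    g : Fin N → A
    g c with c Finₚ.≟ cls Q a
    ... | yes _ = a
    ... | no  _ = rep Q c
    cls-g : ∀ c → cls Q (g c) ≡ c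
    cls-g c with c Finₚ.≟ cls Q a
    ... | yes e = sym e
    ... | no  _ = cls-rep Q c
    g-b : ∀ c → ¬ EqClosure R b (g c)
    g-b c r with c Finₚ.≟ cls Q a
    ... | yes _ = ¬aRb (reverse r)
    ... | no  n = n (trans (sym (cls-rep Q c)) (sound* Q (reverse (extend R⊆S r) ▸ reverse aSb)))
    f : Fin (suc N) → Fin M
    f zero    = cls P b
    f (suc c) = cls P (g c)
    inj : Injective _≡_ _≡_ f
    inj {zero}  {zero}   e = refl
    inj {zero}  {suc c}  e = contradiction (complete P e) (g-b c)
    inj {suc c} {zero}   e = contradiction (complete P (sym e)) (g-b c)
    inj {suc c} {suc c'} e = cong suc (trans (sym (cls-g c))
      (trans (sound* Q (extend R⊆S (complete P e))) (cls-g c')))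

  -- One joined pair merges at most two classes, so the class of `b` gets an index of its own. The
  -- others are told apart by `merge`, an invariant of the joined relation that moves only the class
  -- of `b`.
  join-≤ : ∀ {a b} → (∀ {x y} → S x y → EqClosure (Join R a b) x y) → M ≤ suc N
  join-≤ {a} {b} S⊆R+ab = Finₚ.injective⇒≤ {f = f} inj
    where
    merge : Fin M → Fin M
    merge c with c Finₚ.≟ cls P b
    ... | yes _ = cls P a
    ... | no  _ = c
    merge-other : ∀ {c} → c ≢ cls P b → merge c ≡ c
    merge-other {c} n with c Finₚ.≟ cls P b
    ... | yes e = contradiction e n
    ... | no  _ = refl
    merge-a≡b : merge (cls P a) ≡ merge (cls P b)
    merge-a≡b with cls P b Finₚ.≟ cls P b
    ... | no n = contradiction refl n
    ... | yes _ with cls P a Finₚ.≟ cls P b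
    ...   | yes _ = refl
    ...   | no  _ = refl
    merge-invariant : ∀ {x y} → EqClosure (Join R a b) x y → merge (cls P x) ≡ merge (cls P y)
    merge-invariant = ≡-invariant (merge ∘ cls P)
      λ { (inj₁ r) → cong merge (sound P r) ; (inj₂ (refl , refl)) → merge-a≡b }
    f : Fin M → Fin (suc N)
    f c with c Finₚ.≟ cls P b
    ... | yes _ = zero
    ... | no  _ = suc (cls Q (rep P c))
    inj : Injective _≡_ _≡_ f
    inj {c} {c'} e with c Finₚ.≟ cls P b | c' Finₚ.≟ cls P b
    ... | yes p | yes p' = trans p (sym p')
    ... | yes _ | no  _  = contradiction e λ ()
    ... | no  _ | yes _  = contradiction e λ ()
    ... | no  n | no  n' = begin
      c                      ≡⟨ merge-other n ⟨
      merge c                ≡⟨ cong merge (cls-rep P c) ⟨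
      merge (cls P (rep P c))  ≡⟨ merge-invariant (extend S⊆R+ab (complete Q (Finₚ.suc-injective e))) ⟩
      merge (cls P (rep P c')) ≡⟨ cong merge (cls-rep P c') ⟩
      merge c'               ≡⟨ merge-other n' ⟩
      c'                     ∎
      where open ≡-Reasoning

Classes-cong : ∀ {A : Set} {R S : Rel A 0ℓ} {N} →
  (∀ {x y} → R x y → EqClosure S x y) → (∀ {x y} → S x y → EqClosure R x y) →
  Classes R N → Classes S N
Classes-cong R⊆S S⊆R P = record
  { cls = cls P ; rep = rep P ; cls-rep = cls-rep P
  ; sound = λ s → sound* P (S⊆R s) ; complete = λ e → extend R⊆S (complete P e) }

Classes-join : ∀ {A : Set} {R : Rel A 0ℓ} {N} a b → Classes R N → ∃ (Classes (Join R a b))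
Classes-join {N = N} a b P with cls P a Finₚ.≟ cls P b
... | yes a≡b = N , Classes-cong (step ∘ inj₁) (λ { (inj₁ r) → step r ; (inj₂ (refl , refl)) → complete P a≡b }) P
Classes-join {N = zero}  a b P | no a≢b with () ← cls P a
Classes-join {A} {R} {N = suc N} a b P | no a≢b = N , record
  { cls = merge ∘ cls P ; rep = rep P ∘ punchIn (cls P b)
  ; cls-rep = λ c → trans (cong merge (cls-rep P _)) (merge-punchIn c)
  ; sound = λ { (inj₁ r) → cong merge (sound P r) ; (inj₂ (refl , refl)) → merge-ab }
  ; complete = λ {x} {y} e → toward x ▸ stay (cong (rep P ∘ punchIn (cls P b)) e) ▸ reverse (toward y) }
  where
  b≢a : cls P b ≢ cls P a
  b≢a = a≢b ∘ sym
  merge : Fin (suc N) → Fin N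
  merge c with cls P b Finₚ.≟ c
  ... | yes _ = punchOut b≢a
  ... | no  n = punchOut n
  merge-punchIn : ∀ c → merge (punchIn (cls P b) c) ≡ c
  merge-punchIn c with cls P b Finₚ.≟ punchIn (cls P b) c
  ... | yes e = contradiction (sym e) (Finₚ.punchInᵢ≢i (cls P b) c)
  ... | no  n = Finₚ.punchOut-punchIn (cls P b)
  merge-ab : merge (cls P a) ≡ merge (cls P b)
  merge-ab with cls P b Finₚ.≟ cls P a | cls P b Finₚ.≟ cls P b
  ... | yes e | _     = contradiction e b≢a
  ... | no  _ | no  n = contradiction refl n
  ... | no  n | yes _ = Finₚ.punchOut-cong (cls P b) refl
  R⊆ : ∀ {x y} → EqClosure R x y → EqClosure (Join R a b) x y
  R⊆ = extend (step ∘ inj₁)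
  toward : ∀ x → EqClosure (Join R a b) x (rep P (punchIn (cls P b) (merge (cls P x))))
  toward x with cls P b Finₚ.≟ cls P x
  ... | yes e = R⊆ (complete P (sym e)) ▸ reverse (step (inj₂ (refl , refl)))
              ▸ R⊆ (complete P (sym (trans (cls-rep P _) (Finₚ.punchIn-punchOut b≢a))))
  ... | no  n = R⊆ (complete P (sym (trans (cls-rep P _) (Finₚ.punchIn-punchOut n))))

Classes-discrete : ∀ {A : Set} {M} (to : A → Fin M) (from : Fin M → A) →
  (∀ c → to (from c) ≡ c) → Injective _≡_ _≡_ to → Classes {A} (λ _ _ → ⊥) M
Classes-discrete to from to-from to-inj = record
  { cls = to ; rep = from ; cls-rep = to-from ; sound = ⊥-elim ; complete = stay ∘ to-inj }

Joins : ∀ {A : Set} → List (A × A) → Rel A 0ℓ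
Joins []              = λ _ _ → ⊥
Joins ((a , b) ∷ abs) = Join (Joins abs) a b

∈⇒Joins : ∀ {A : Set} {abs} {a b : A} → (a , b) ∈ abs → Joins abs a b
∈⇒Joins (here refl) = inj₂ (refl , refl)
∈⇒Joins (there i)   = inj₁ (∈⇒Joins i)

Joins⇒∈ : ∀ {A : Set} abs {a b : A} → Joins abs a b → (a , b) ∈ abs
Joins⇒∈ (_ ∷ abs) (inj₁ j)             = there (Joins⇒∈ abs j)
Joins⇒∈ (_ ∷ abs) (inj₂ (refl , refl)) = here refl

Classes-exist : ∀ {A : Set} {M} → Classes {A} (λ _ _ → ⊥) M → ∀ abs → ∃ (Classes (Joins abs))
Classes-exist P []              = _ , P
Classes-exist P ((a , b) ∷ abs) = Classes-join a b (proj₂ (Classes-exist P abs))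

-- Detaching darts from a combinatorial map

Orb : ∀ {A : Set} → (A → A) → Rel A 0ℓ
Orb f x y = f x ≡ y

iter-+ : ∀ {A : Set} s t (f : A → A) x → iter (s + t) f x ≡ iter s f (iter t f x)
iter-+ zero    t f x = refl
iter-+ (suc s) t f x = cong f (iter-+ s t f x)

iter-injective : ∀ {A : Set} {f : A → A} → Injective _≡_ _≡_ f → ∀ t → Injective _≡_ _≡_ (iter t f)
iter-injective inj zero    e = e
iter-injective inj (suc t) e = iter-injective inj t (inj e)

iter-orbit : ∀ {A : Set} (f : A → A) t x → EqClosure (Orb f) x (iter t f x)
iter-orbit f zero    x = stay refl
iter-orbit f (suc t) x = iter-orbit f t x ▸ step refl

-- π′ = π ∘ (a b).
record Switched {A : Set} (π π′ : A → A) (a b : A) : Set where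
  field
    at-a  : π′ a ≡ π b
    at-b  : π′ b ≡ π a
    other : ∀ {x} → x ≢ a → x ≢ b → π′ x ≡ π x

Switched-sym : ∀ {A : Set} {π π′ : A → A} {a b} → Switched π π′ a b → Switched π′ π a b
Switched-sym s = record { at-a = sym at-b ; at-b = sym at-a ; other = λ n n' → sym (other n n') }
  where open Switched s

-- Permutations of a finite set and their orbits

module Permutations {A : Set} {M : ℕ} (fin : A ↔ Fin M) where

  _≟_ : DecidableEquality A
  _≟_ = Finₚ.inj⇒≟ (↔⇒↣ fin)

  private
    code : A → Fin M
    code = Inverse.to fin

    code-injective : Injective _≡_ _≡_ code
    code-injective = Injection.injective (↔⇒↣ fin)

    discrete : Classes {A} (λ _ _ → ⊥) M
    discrete = Classes-discrete code (Inverse.from fin) (Inverse.strictlyInverseˡ fin) code-injective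

    elements : List A
    elements = map (Inverse.from fin) (allFin M)

    ∈-elements : ∀ x → x ∈ elements
    ∈-elements x = subst (_∈ elements) (Inverse.strictlyInverseʳ fin x)
      (∈-map⁺ (Inverse.from fin) (∈-allFin (code x)))

  ∃-classes : ∀ (R : Rel A 0ℓ) (abs : List (A × A)) →
    (∀ {x y} → R x y → (x , y) ∈ abs) → (∀ {x y} → (x , y) ∈ abs → R x y) → ∃ (Classes R)
  ∃-classes R abs R⇒∈ ∈⇒R =
    let N , P = Classes-exist discrete abs
    in  N , Classes-cong (λ j → step (∈⇒R (Joins⇒∈ abs j))) (λ r → step (∈⇒Joins (R⇒∈ r))) P

  ∃-orbits : ∀ f → ∃ (Classes (Orb f))
  ∃-orbits f = ∃-classes (Orb f) (map (λ x → x , f x) elements)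
    (λ { {x} refl → ∈-map⁺ (λ x → x , f x) (∈-elements x) })
    (λ i → case-∈ (∈-map⁻ (λ x → x , f x) i))
    where
    case-∈ : ∀ {x y} → (∃ λ z → z ∈ elements × (x , y) ≡ (z , f z)) → f x ≡ y
    case-∈ (_ , _ , refl) = refl

  module _ {f : A → A} (inj : Injective _≡_ _≡_ f) where

    period : ∀ x → ∃ λ t → t < M × iter (suc t) f x ≡ x
    period x with Finₚ.pigeonhole (ℕₚ.n<1+n M) (λ i → code (iter (toℕ i) f x))
    ... | i , j , i<j , e = t , t<M , iter-injective inj (toℕ i) (begin
      iter (toℕ i) f (iter (suc t) f x) ≡⟨ iter-+ (toℕ i) (suc t) f x ⟨
      iter (toℕ i + suc t) f x          ≡⟨ cong (λ t → iter t f x) i+1+t≡j ⟩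
      iter (toℕ j) f x                  ≡⟨ code-injective e ⟨
      iter (toℕ i) f x                  ∎)
      where
      open ≡-Reasoning
      t : ℕ
      t = toℕ j ℕ.∸ suc (toℕ i)
      i+1+t≡j : toℕ i + suc t ≡ toℕ j
      i+1+t≡j = trans (ℕₚ.+-suc (toℕ i) t) (ℕₚ.m+[n∸m]≡n i<j)
      t<M : t < M
      t<M = ℕₚ.≤-trans (ℕₚ.m≤n+m (suc t) (toℕ i)) (subst (_≤ M) (sym i+1+t≡j) (Finₚ.toℕ≤pred[n] j))

    -- `orbitCount` tests only the iterates below `2 * m`, the number of darts. This bound shows
    -- that such a window sees a whole orbit.
    iter-bounded : ∀ x s → ∃ λ t → t < M × iter t f x ≡ iter s f x
    iter-bounded x s with period x
    ... | t , t<M , e = let u , u<1+t , e′ = reduce s in u , ℕₚ.<-≤-trans u<1+t t<M , e′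
      where
      reduce : ∀ s → ∃ λ u → u < suc t × iter u f x ≡ iter s f x
      reduce zero    = 0 , s≤s z≤n , refl
      reduce (suc s) with reduce s
      ... | u , u<1+t , e′ with suc u ℕ.<? suc t
      ...   | yes 1+u<1+t = suc u , 1+u<1+t , cong f e′
      ...   | no  1+u≮1+t = 0 , s≤s z≤n , trans (sym (trans (cong (λ v → iter v f x) 1+u≡1+t) e)) (cong f e′)
        where
        1+u≡1+t : suc u ≡ suc t
        1+u≡1+t = ℕₚ.≤-antisym u<1+t (ℕₚ.≮⇒≥ 1+u≮1+t)

    preimage : ∀ x → ∃ λ y → f y ≡ x
    preimage x = let t , _ , e = period x in iter t f x , e

    -- `EqClosure` also allows backward steps; on a finite set an injection undoes a step by going
    -- round the rest of the cycle.
    orbit⇒iter : ∀ {x y} → EqClosure (Orb f) x y → ∃ λ t → iter t f x ≡ y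
    orbit⇒iter = Eq.fold {S = λ x y → ∃ λ t → iter t f x ≡ y} record
      { refl  = 0 , refl
      ; sym   = λ { {x} (t , refl) → undo t x }
      ; trans = λ { {x} (s , refl) (t , refl) → t + s , iter-+ t s f x } }
      (λ { refl → 1 , refl })
      where
      undo : ∀ t x → ∃ λ s → iter s f (iter t f x) ≡ x
      undo zero    x = 0 , refl
      undo (suc t) x with period (iter t f x) | undo t x
      ... | p , _ , e | s , e′ = s + p , trans (iter-+ s p f _) (trans (cong (iter s f) (trans (iter-comm p _) e)) e′)
        where
        iter-comm : ∀ p x → iter p f (f x) ≡ f (iter p f x)
        iter-comm zero    x = refl
        iter-comm (suc p) x = cong f (iter-comm p x)

    fixed-orbit : ∀ {x y} → f x ≡ x → EqClosure (Orb f) x y → x ≡ y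
    fixed-orbit {x} fx≡x r = let t , e = orbit⇒iter r in trans (sym (constant t)) e
      where
      constant : ∀ t → iter t f x ≡ x
      constant zero    = refl
      constant (suc t) = trans (cong f (constant t)) fx≡x

  module _ {π π′ : A → A} {a b : A} (sw : Switched π π′ a b) where
    open Switched sw

    switched⊆join : ∀ {x y} → Orb π′ x y → EqClosure (Join (Orb π) a b) x y
    switched⊆join {x} refl with x ≟ a | x ≟ b
    ... | yes refl | _        = step (inj₂ (refl , refl)) ▸ step (inj₁ (sym at-a))
    ... | no _     | yes refl = reverse (step (inj₂ (refl , refl))) ▸ step (inj₁ (sym at-b))
    ... | no x≢a   | no x≢b   = step (inj₁ (sym (other x≢a x≢b)))

  -- Follow π from a: it runs along the π′-orbit of b, which avoids a, until it meets b.
  switched-joins : ∀ {π π′ a b} → Injective _≡_ _≡_ π′ → Switched π′ π a b →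
    ¬ EqClosure (Orb π′) a b → EqClosure (Orb π) a b
  switched-joins {π} {π′} {a} {b} inj′ sw a≁b with period inj′ b
  ... | t , _ , e with follow t
    where
    open Switched sw
    follow : ∀ t → (EqClosure (Orb π) a b) ⊎ (iter (suc t) π a ≡ iter (suc t) π′ b)
    follow zero    = inj₂ at-a
    follow (suc t) with follow t
    ... | inj₁ r = inj₁ r
    ... | inj₂ e with iter (suc t) π′ b in eq
    ...   | x with x ≟ b | x ≟ a
    ...     | yes refl | _        = inj₁ (iter-orbit π (suc t) a ▸ stay e)
    ...     | no _     | yes refl = contradiction (reverse (iter-orbit π′ (suc t) b ▸ stay eq)) a≁b
    ...     | no x≢b   | no x≢a   = inj₂ (trans (cong π e) (other x≢a x≢b))
  ...   | inj₁ r  = r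
  ...   | inj₂ e′ = iter-orbit π (suc t) a ▸ stay (trans e′ e)

  module Maps (α : A → A) (α-involutive : ∀ x → α (α x) ≡ x) where

    Adjacent : (A → A) → Rel A 0ℓ
    Adjacent σ x y = σ x ≡ y ⊎ α x ≡ y

    ∃-components : ∀ σ → ∃ (Classes (Adjacent σ))
    ∃-components σ = ∃-classes (Adjacent σ)
      (map (λ x → x , σ x) elements ++ map (λ x → x , α x) elements)
      (λ { {x} (inj₁ refl) → ∈-++⁺ˡ (∈-map⁺ (λ x → x , σ x) (∈-elements x))
         ; {x} (inj₂ refl) → ∈-++⁺ʳ _ (∈-map⁺ (λ x → x , α x) (∈-elements x)) })
      (λ i → from-∈ (∈-++⁻ (map (λ x → x , σ x) elements) i))
      where
      from-∈ : ∀ {x y} → (x , y) ∈ map (λ x → x , σ x) elements ⊎ (x , y) ∈ map (λ x → x , α x) elements →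
        Adjacent σ x y
      from-∈ (inj₁ i) with _ , _ , refl ← ∈-map⁻ (λ x → x , σ x) i = inj₁ refl
      from-∈ (inj₂ i) with _ , _ , refl ← ∈-map⁻ (λ x → x , α x) i = inj₂ refl

    faces⊆components : ∀ {σ x y} → EqClosure (Orb (σ ∘ α)) x y → EqClosure (Adjacent σ) x y
    faces⊆components = extend λ r → step (inj₂ refl) ▸ step (inj₁ r)

    module _ {σ σ′ : A → A} (inj : Injective _≡_ _≡_ σ) (inj′ : Injective _≡_ _≡_ σ′)
             {p d : A} (sw : Switched σ σ′ p d) (σp≡d : σ p ≡ d) (p≢d : p ≢ d) where
      open Switched sw

      private
        Orb⊆ : ∀ {x y} → Orb σ′ x y → EqClosure (Orb σ) x y
        Orb⊆ r = extend (λ { (inj₁ s) → step s ; (inj₂ (refl , refl)) → step σp≡d }) (switched⊆join sw r)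

        face-switch : Switched (σ ∘ α) (σ′ ∘ α) (α p) (α d)
        face-switch = record
          { at-a  = trans (cong σ′ (α-involutive p)) (trans at-a (cong σ (sym (α-involutive d))))
          ; at-b  = trans (cong σ′ (α-involutive d)) (trans at-b (cong σ (sym (α-involutive p))))
          ; other = λ x≢αp x≢αd → other (x≢αp ∘ flip-≡) (x≢αd ∘ flip-≡) }
          where
          flip-≡ : ∀ {x y} → α x ≡ y → x ≡ α y
          flip-≡ refl = sym (α-involutive _)

        face-injective : Injective _≡_ _≡_ (σ′ ∘ α)
        face-injective {x} {y} e =
          trans (sym (α-involutive x)) (trans (cong α (inj′ e)) (α-involutive y))

        Adjacent⊆join : ∀ {x y} → Adjacent σ x y → EqClosure (Join (Adjacent σ′) p d) x y
        Adjacent⊆join (inj₂ r) = step (inj₁ (inj₂ r))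
        Adjacent⊆join (inj₁ r) = extend (λ { (inj₁ s) → step (inj₁ (inj₁ s)) ; (inj₂ e) → step (inj₂ e) })
          (switched⊆join (Switched-sym sw) r)

      module _ {V V′ F F′ C C′ : ℕ} (cV : Classes (Orb σ) V) (cV′ : Classes (Orb σ′) V′)
               (cF : Classes (Orb (σ ∘ α)) F) (cF′ : Classes (Orb (σ′ ∘ α)) F′)
               (cC : Classes (Adjacent σ) C) (cC′ : Classes (Adjacent σ′) C′) where

        -- Since `σ′ d = σ p = d`, the switch cuts `d` out of its cycle as a fixed point and closes
        -- up the rest, so exactly one orbit is gained.
        detach-vertices : V′ ≡ suc V
        detach-vertices = ℕₚ.≤-antisym
          (join-≤ cV′ cV (switched⊆join (Switched-sym sw)))
          (refinement-< cV′ cV Orb⊆ (step σp≡d)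
            λ r → p≢d (sym (fixed-orbit inj′ (trans at-b σp≡d) (reverse r))))

        -- If αp and αd share a face of the new map, then p and d are still connected. Otherwise the two
        -- new faces come from a single old one, which pays for a possible new component.
        detach-defect : 2 * C′ + (V + F) ≤ 2 * C + (V′ + F′)
        detach-defect with cls cF′ (α p) Finₚ.≟ cls cF′ (α d)
        ... | yes same = begin
          2 * C′ + (V + F)        ≤⟨ ℕₚ.+-mono-≤ (ℕₚ.*-monoʳ-≤ 2 C′≤C) (ℕₚ.+-monoʳ-≤ V F≤1+F′) ⟩
          2 * C + (V + suc F′)    ≡⟨ cong (2 * C +_) (ℕₚ.+-suc V F′) ⟩
          2 * C + (suc V + F′)    ≡⟨ cong (λ v → 2 * C + (v + F′)) detach-vertices ⟨
          2 * C + (V′ + F′)       ∎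
          where
          open ℕₚ.≤-Reasoning
          p~d : EqClosure (Adjacent σ′) p d
          p~d = step (inj₂ refl) ▸ faces⊆components (complete cF′ same) ▸ step (inj₂ (α-involutive d))
          C′≤C : C′ ≤ C
          C′≤C = refinement-≤ cC cC′ λ r → extend
            (λ { (inj₁ s) → step s ; (inj₂ (refl , refl)) → p~d }) (Adjacent⊆join r)
          F≤1+F′ : F ≤ suc F′
          F≤1+F′ = join-≤ cF cF′ (switched⊆join face-switch)
        ... | no different = begin
          2 * C′ + (V + F)          ≤⟨ ℕₚ.+-monoˡ-≤ (V + F) (ℕₚ.*-monoʳ-≤ 2 C′≤1+C) ⟩
          2 * suc C + (V + F)       ≡⟨ solve 3 (λ c v f → con 2 :* (con 1 :+ c) :+ (v :+ f)
                                        := con 2 :* c :+ ((con 1 :+ v) :+ (con 1 :+ f))) refl C V F ⟩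
          2 * C + (suc V + suc F)   ≤⟨ ℕₚ.+-monoʳ-≤ (2 * C) (ℕₚ.+-monoʳ-≤ (suc V) 1+F≤F′) ⟩
          2 * C + (suc V + F′)      ≡⟨ cong (λ v → 2 * C + (v + F′)) detach-vertices ⟨
          2 * C + (V′ + F′)         ∎
          where
          open ℕₚ.≤-Reasoning
          open +-*-Solver
          C′≤1+C : C′ ≤ suc C
          C′≤1+C = join-≤ cC′ cC Adjacent⊆join
          αp≁αd : ¬ EqClosure (Orb (σ′ ∘ α)) (α p) (α d)
          αp≁αd = different ∘ sound* cF′
          αp~αd : EqClosure (Orb (σ ∘ α)) (α p) (α d)
          αp~αd = switched-joins face-injective (Switched-sym face-switch) αp≁αd
          1+F≤F′ : suc F ≤ F′
          1+F≤F′ = refinement-< cF′ cF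
            (λ r → extend (λ { (inj₁ s) → step s ; (inj₂ (refl , refl)) → αp~αd })
              (switched⊆join face-switch r))
            αp~αd αp≁αd

    -- With M = 2m darts throughout, twice the genus is 2C + m - V - F; the field defect says that it is
    -- not larger for σ′ than for σ.
    record Detached (σ : A → A) {V F C} (cV : Classes (Orb σ) V) (cF : Classes (Orb (σ ∘ α)) F)
                    (cC : Classes (Adjacent σ) C) (ds : List A) : Set where
      field
        σ′         : A → A
        injective  : Injective _≡_ _≡_ σ′
        V′ F′ C′   : ℕ
        vertices   : Classes (Orb σ′) V′
        faces      : Classes (Orb (σ′ ∘ α)) F′
        components : Classes (Adjacent σ′) C′
        V′≤        : V′ ≤ V + length ds
        defect     : 2 * C′ + (V + F) ≤ 2 * C + (V′ + F′)
        preserved  : ∀ x → EqClosure (Orb σ) x (σ′ x)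
        detached   : ∀ {x} → x ∈ ds → σ′ x ≡ x

    detach : ∀ {σ} → Injective _≡_ _≡_ σ → ∀ {V F C} cV cF cC ds → Detached σ {V} {F} {C} cV cF cC ds
    detach {σ} inj {V} {F} {C} cV cF cC [] = record
      { σ′ = σ ; injective = inj ; vertices = cV ; faces = cF ; components = cC
      ; V′≤ = ℕₚ.≤-reflexive (sym (ℕₚ.+-identityʳ V)) ; defect = ℕₚ.≤-refl
      ; preserved = λ x → step refl ; detached = λ () }
    detach {σ} inj {V} {F} {C} cV cF cC (d ∷ ds) with detach inj cV cF cC ds
    ... | D with σ′ d ≟ d
      where open Detached D
    -- A dart that is already fixed is left alone and adds no orbit, which makes `V′≤` only an
    -- inequality.
    ...   | yes σ′d≡d = record
      { Detached D
      ; V′≤ = ℕₚ.≤-trans V′≤ (ℕₚ.+-monoʳ-≤ V (ℕₚ.n≤1+n _))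
      ; detached = λ { (here refl) → σ′d≡d ; (there i) → detached i } }
      where open Detached D
    ...   | no σ′d≢d with preimage (Detached.injective D) d
    ...     | p , σ′p≡d = record
      { σ′ = σ″ ; injective = injective″
      ; vertices = proj₂ (∃-orbits σ″) ; faces = proj₂ (∃-orbits (σ″ ∘ α)) ; components = proj₂ (∃-components σ″)
      ; V′≤ = subst₂ _≤_ (sym vertices″) (sym (ℕₚ.+-suc V (length ds))) (s≤s V′≤)
      -- Telescoping: the inequalities for the passage from `σ` to `σ′` and from `σ′` to `σ″` are
      -- added, and the counts of `σ′` are cancelled.
      ; defect = ℕₚ.+-cancelˡ-≤ (2 * C′ + (V′ + F′)) _ _ (begin
          (2 * C′ + (V′ + F′)) + (2 * C″ + (V + F))
            ≡⟨ exchange (2 * C′) (V′ + F′) (2 * C″) (V + F) ⟩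
          (2 * C′ + (V + F)) + (2 * C″ + (V′ + F′))
            ≤⟨ ℕₚ.+-mono-≤ defect (detach-defect injective injective″ switched σ′p≡d p≢d
                 vertices (proj₂ (∃-orbits σ″)) faces (proj₂ (∃-orbits (σ″ ∘ α)))
                 components (proj₂ (∃-components σ″))) ⟩
          (2 * C + (V′ + F′)) + (2 * C′ + (V″ + F″))
            ≡⟨ exchange′ (2 * C) (V′ + F′) (2 * C′) (V″ + F″) ⟩
          (2 * C′ + (V′ + F′)) + (2 * C + (V″ + F″)) ∎)
      ; preserved = preserved″
      ; detached = λ { (here refl) → σ″-d ; (there i) → σ″-fixed (detached i) } }
      where
      open Detached D
      open ℕₚ.≤-Reasoning
      open +-*-Solver
      exchange : ∀ a b c e → (a + b) + (c + e) ≡ (a + e) + (c + b)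
      exchange = solve 4 (λ a b c e → (a :+ b) :+ (c :+ e) := (a :+ e) :+ (c :+ b)) refl
      exchange′ : ∀ a b c e → (a + b) + (c + e) ≡ (c + b) + (a + e)
      exchange′ = solve 4 (λ a b c e → (a :+ b) :+ (c :+ e) := (c :+ b) :+ (a :+ e)) refl
      p≢d : p ≢ d
      p≢d refl = σ′d≢d σ′p≡d
      transpose : A → A
      transpose x with x ≟ p | x ≟ d
      ... | yes _ | _     = d
      ... | no _  | yes _ = p
      ... | no _  | no _  = x
      transpose-p : transpose p ≡ d
      transpose-p with p ≟ p
      ... | yes _ = refl
      ... | no n  = contradiction refl n
      transpose-d : transpose d ≡ p
      transpose-d with d ≟ p | d ≟ d
      ... | yes e | _     = e
      ... | no _  | yes _ = refl
      ... | no _  | no n  = contradiction refl n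
      transpose-other : ∀ {x} → x ≢ p → x ≢ d → transpose x ≡ x
      transpose-other {x} x≢p x≢d with x ≟ p | x ≟ d
      ... | yes e | _     = contradiction e x≢p
      ... | no _  | yes e = contradiction e x≢d
      ... | no _  | no _  = refl
      transpose-involutive : ∀ x → transpose (transpose x) ≡ x
      transpose-involutive x = by-cases (x ≟ p) (x ≟ d)
        where
        by-cases : Dec (x ≡ p) → Dec (x ≡ d) → transpose (transpose x) ≡ x
        by-cases (yes refl) _          = trans (cong transpose transpose-p) transpose-d
        by-cases (no _)     (yes refl) = trans (cong transpose transpose-d) transpose-p
        by-cases (no x≢p)   (no x≢d)   = trans (cong transpose (transpose-other x≢p x≢d)) (transpose-other x≢p x≢d)
      σ″ : A → A
      σ″ = σ′ ∘ transpose
      injective″ : Injective _≡_ _≡_ σ″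
      injective″ {x} {y} e = trans (sym (transpose-involutive x)) (trans (cong transpose (injective e)) (transpose-involutive y))
      switched : Switched σ′ σ″ p d
      switched = record { at-a = cong σ′ transpose-p ; at-b = cong σ′ transpose-d ; other = λ n n′ → cong σ′ (transpose-other n n′) }
      V″ F″ C″ : ℕ
      V″ = proj₁ (∃-orbits σ″)
      F″ = proj₁ (∃-orbits (σ″ ∘ α))
      C″ = proj₁ (∃-components σ″)
      vertices″ : V″ ≡ suc V′
      vertices″ = detach-vertices injective injective″ switched σ′p≡d p≢d
        vertices (proj₂ (∃-orbits σ″)) faces (proj₂ (∃-orbits (σ″ ∘ α))) components (proj₂ (∃-components σ″))
      preserved″ : ∀ x → EqClosure (Orb σ) x (σ″ x)
      preserved″ x = extend (λ { (inj₁ refl) → preserved _ ; (inj₂ (refl , refl)) → preserved p ▸ stay σ′p≡d })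
        (switched⊆join switched refl)
      σ″-d : σ″ d ≡ d
      σ″-d = trans (cong σ′ transpose-d) σ′p≡d
      -- The switch affects only `p` and `d`, neither of which is fixed by `σ′`, so earlier
      -- detachments persist.
      σ″-fixed : ∀ {x} → σ′ x ≡ x → σ″ x ≡ x
      σ″-fixed {x} σ′x≡x = trans (cong σ′ (transpose-other x≢p x≢d)) σ′x≡x
        where
        x≢p : x ≢ p
        x≢p refl = p≢d (trans (sym σ′x≡x) σ′p≡d)
        x≢d : x ≢ d
        x≢d refl = σ′d≢d σ′x≡x

-- Orbit and component counts of a graph

lookup-injective : ∀ {A : Set} {xs : List A} → Unique xs → Injective _≡_ _≡_ (lookup xs)
lookup-injective {xs = _ ∷ xs} (_ ∷ _) {zero}  {zero}  e = refl
lookup-injective {xs = _ ∷ xs} (x∉ ∷ _) {zero}  {suc j} e = contradiction e (All.lookup x∉ (∈-lookup j))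
lookup-injective {xs = _ ∷ xs} (x∉ ∷ _) {suc i} {zero}  e = contradiction (sym e) (All.lookup x∉ (∈-lookup i))
lookup-injective {xs = _ ∷ xs} (_ ∷ u)  {suc i} {suc j} e = cong suc (lookup-injective u e)

all-true : ∀ {A : Set} (p : A → Bool) xs → (∀ x → T (p x)) → T (all p xs)
all-true p xs t = Allₚ.all⁻ p {xs} (All.tabulate λ {x} _ → t x)

module _ {A : Set} {p : A → Bool} {xs : List A} {N : ℕ} where

  countᵇ-≤ : Unique xs → (f : A → Fin N) →
    (∀ {x y} → T (p x) → T (p y) → f x ≡ f y → x ≡ y) → countᵇ p xs ≤ N
  countᵇ-≤ u f inj = Finₚ.injective⇒≤ {f = f ∘ lookup (filterᵇ p xs)} λ {i} {j} e →
    lookup-injective (Uniqueₚ.filter⁺ (T? ∘ p) u) (inj (selected i) (selected j) e)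
    where
    selected : ∀ i → T (p (lookup (filterᵇ p xs) i))
    selected i = proj₂ (∈-filter⁻ (T? ∘ p) {xs = xs} (∈-lookup {xs = filterᵇ p xs} i))

  countᵇ-≥ : (g : Fin N → A) → Injective _≡_ _≡_ g →
    (∀ c → g c ∈ xs) → (∀ c → T (p (g c))) → N ≤ countᵇ p xs
  countᵇ-≥ g inj g∈ pg = Finₚ.injective⇒≤ {f = index} λ {c} {c′} e →
    inj (trans (Anyₚ.lookup-index (member c))
      (trans (cong (lookup (filterᵇ p xs)) e) (sym (Anyₚ.lookup-index (member c′)))))
    where
    member : ∀ c → g c ∈ filterᵇ p xs
    member c = ∈-filter⁺ (T? ∘ p) (g∈ c) (pg c)
    index : Fin N → Fin (countᵇ p xs)
    index = Any.index ∘ member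

module Darts {V : Set} (G : Graph V) where

  D : Set
  D = Dart G

  M : ℕ
  M = m G * 2

  dart-fin : D ↔ Fin M
  dart-fin = ↔-sym (↔-trans (Finₚ.*↔×) (↔-refl ×-↔ Finₚ.2↔Bool))

  flip-involutive : ∀ d → flip G (flip G d) ≡ d
  flip-involutive (e , b) = cong (e ,_) (Boolₚ.not-involutive b)

  open Permutations dart-fin public
  open Maps (flip G) flip-involutive public

  κ : D → ℕ
  κ = key {G = G}

  key-injective : Injective _≡_ _≡_ κ
  key-injective {e , false} {e′ , false} eq = cong (_, false) (Finₚ.toℕ-injective
    (ℕₚ.*-cancelˡ-≡ _ _ 2 (ℕₚ.+-cancelʳ-≡ 0 _ _ eq)))
  key-injective {e , true}  {e′ , true}  eq = cong (_, true) (Finₚ.toℕ-injective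
    (ℕₚ.*-cancelˡ-≡ _ _ 2 (ℕₚ.+-cancelʳ-≡ 1 _ _ eq)))
  key-injective {e , false} {e′ , true}  eq = contradiction
    (trans (sym (ℕₚ.+-identityʳ _)) (trans eq (ℕₚ.+-comm _ 1))) (ℕₚ.even≢odd (toℕ e) (toℕ e′))
  key-injective {e , true}  {e′ , false} eq = contradiction
    (trans (sym (ℕₚ.+-identityʳ _)) (trans (sym eq) (ℕₚ.+-comm _ 1))) (ℕₚ.even≢odd (toℕ e′) (toℕ e))

  ∈-darts : ∀ d → d ∈ darts G
  ∈-darts (e , b) = ∈-concatMap⁺ _ (lose (∈-allFin e) (member b))
    where
    member : ∀ b → (e , b) ∈ (e , false) ∷ (e , true) ∷ []
    member false = here refl
    member true  = there (here refl)

  darts-unique : Unique (darts G)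
  darts-unique = Uniqueₚ.concat⁺
    (Allₚ.map⁺ (All.tabulate λ {e} _ → ((λ ()) ∷ []) ∷ [] ∷ []))
    (AllPairsₚ.map⁺ (AllPairs.map disjoint (Uniqueₚ.allFin⁺ (m G))))
    where
    disjoint : ∀ {e e′} → e ≢ e′ → ∀ {d} →
      ¬ (d ∈ (e , false) ∷ (e , true) ∷ [] × d ∈ (e′ , false) ∷ (e′ , true) ∷ [])
    disjoint n (here refl         , here refl)         = n refl
    disjoint n (here refl         , there (here ()))
    disjoint n (there (here refl) , here ())
    disjoint n (there (here refl) , there (here refl)) = n refl

  ==ᵈ⇒≡ : ∀ {d d′} → T (_==ᵈ_ {G = G} d d′) → d ≡ d′
  ==ᵈ⇒≡ {e , b} {e′ , b′} t =
    let t₁ , t₂ = Equivalence.to (Boolₚ.T-∧ {⌊ e Finₚ.≟ e′ ⌋} {⌊ b Boolₚ.≟ b′ ⌋}) t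
    in  cong₂ _,_ (toWitness {a? = e Finₚ.≟ e′} t₁) (toWitness {a? = b Boolₚ.≟ b′} t₂)

  ==ᵈ-refl : ∀ d → T (_==ᵈ_ {G = G} d d)
  ==ᵈ-refl (e , b) = Equivalence.from (Boolₚ.T-∧ {⌊ e Finₚ.≟ e ⌋} {⌊ b Boolₚ.≟ b ⌋})
    (fromWitness {a? = e Finₚ.≟ e} refl , fromWitness {a? = b Boolₚ.≟ b} refl)

  module _ {N : ℕ} (colour : D → Fin N) (sample : Fin N → D) (colour-sample : ∀ c → colour (sample c) ≡ c) where

    open Extrema ℕₚ.≤-totalOrder using (argmin; argmin-all; f[argmin]≤f[xs])

    private
      coloured : Fin N → List D
      coloured c = filter (λ d → colour d Finₚ.≟ c) (darts G)

    least : Fin N → D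
    least c = argmin κ (sample c) (coloured c)

    colour-least : ∀ c → colour (least c) ≡ c
    colour-least c = argmin-all κ {P = λ d → colour d ≡ c} (colour-sample c)
      (All.tabulate λ i → proj₂ (∈-filter⁻ (λ d → colour d Finₚ.≟ c) {xs = darts G} i))

    least-≤ : ∀ c {d} → colour d ≡ c → κ (least c) ≤ κ d
    least-≤ c e = All.lookup (f[argmin]≤f[xs] {f = κ} (sample c) (coloured c))
      (∈-filter⁺ (λ d → colour d Finₚ.≟ c) (∈-darts _) e)

    least-injective : Injective _≡_ _≡_ least
    least-injective e = trans (sym (colour-least _)) (trans (cong colour e) (colour-least _))

    -- Orbits are monochromatic, so the least dart of a colour is least in its orbit and is counted.
    -- No orbit has to be determined: any invariant that attains `N` values will do.
    orbitCount-≥ : ∀ f → (∀ d → colour (f d) ≡ colour d) → N ≤ orbitCount G f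
    orbitCount-≥ f invariant = countᵇ-≥ least least-injective (∈-darts ∘ least)
      λ c → all-true _ (upTo (2 * m G)) (λ t → ℕₚ.≤⇒≤ᵇ (least-≤ c (trans (invariants t _) (colour-least c))))
      where
      invariants : ∀ t d → colour (iter t f d) ≡ colour d
      invariants zero    d = refl
      invariants (suc t) d = trans (invariant _) (invariants t d)

  -- Two counted darts of one orbit have keys bounded by each other, so they coincide.
  orbitCount-≤ : ∀ {f N} → Injective _≡_ _≡_ f → Classes (Orb f) N → orbitCount G f ≤ N
  orbitCount-≤ {f} inj P = countᵇ-≤ darts-unique (cls P) λ t t′ e →
    key-injective (ℕₚ.≤-antisym (bound t (complete P e)) (bound t′ (complete P (sym e))))
    where
    bound : ∀ {d d′} → T (all (λ t → κ d ≤ᵇ κ (iter t f d)) (upTo (2 * m G))) →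
      EqClosure (Orb f) d d′ → κ d ≤ κ d′
    bound {d} minimal r with orbit⇒iter inj r
    ... | s , refl with iter-bounded inj d s
    ...   | t , t<M , e = subst (λ x → κ d ≤ κ x) e (ℕₚ.≤ᵇ⇒≤ _ _ (All.lookup
            (Allₚ.all⁺ _ (upTo (2 * m G)) minimal) (∈-upTo⁺ (subst (t <_) (ℕₚ.*-comm (m G) 2) t<M))))

  module _ (σ : D → D) where

    close-sound : ∀ k S {d} → T (close G σ k S d) → ∃ λ d₀ → T (S d₀) × EqClosure (Adjacent σ) d₀ d
    close-sound zero    S t = _ , t , stay refl
    close-sound (suc k) S t with close-sound k _ t
    ... | d₁ , t₁ , r with Equivalence.to Boolₚ.T-∨ t₁
    ...   | inj₁ s = d₁ , s , r
    ...   | inj₂ s with find (Anyₚ.any⁻ _ (darts G) s)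
    ...     | d₀ , _ , s₀ with Equivalence.to Boolₚ.T-∧ s₀
    ...       | sd₀ , s₁ with Equivalence.to Boolₚ.T-∨ s₁
    ...         | inj₁ e = d₀ , sd₀ , step (inj₁ (==ᵈ⇒≡ e)) ▸ r
    ...         | inj₂ e = d₀ , sd₀ , step (inj₂ (==ᵈ⇒≡ e)) ▸ r

    compOf-sound : ∀ {d d′} → T (compOf G σ d d′) → EqClosure (Adjacent σ) d d′
    compOf-sound {d} t with close-sound (2 * m G) _ t
    ... | d₀ , t₀ , r = stay (sym (==ᵈ⇒≡ t₀)) ▸ r

    -- Soundness of `compOf` suffices: a dart that is least in its class is least among whatever
    -- part of the class `compOf` finds.
    compCount-≥ : ∀ {N} → Classes (Adjacent σ) N → N ≤ compCount G σ
    compCount-≥ P = countᵇ-≥ (least (cls P) (rep P) (cls-rep P)) (least-injective (cls P) (rep P) (cls-rep P))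
      (∈-darts ∘ _) λ c → all-true _ (darts G) (λ d′ → implies {compOf G σ _ d′} (λ t → ℕₚ.≤⇒≤ᵇ
        (least-≤ (cls P) (rep P) (cls-rep P) c (trans (sym (sound* P (compOf-sound t)))
          (colour-least (cls P) (rep P) (cls-rep P) c)))))
      where
      implies : ∀ {a b} → (T a → T b) → T (not a ∨ b)
      implies {false} f = _
      implies {true}  f = f _

    -- Moves go forward only and are counted, because `close` never inverts `σ` and `compOf` runs it
    -- for just `2 * m` rounds.
    data Steps : ℕ → D → D → Set where
      start : ∀ {d} → Steps 0 d d
      rotate : ∀ {k d d′} → Steps k (σ d) d′ → Steps (suc k) d d′
      turn   : ∀ {k d d′} → Steps k (flip G d) d′ → Steps (suc k) d d′

    close-⊇ : ∀ k S {d} → T (S d) → T (close G σ k S d)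
    close-⊇ zero    S t = t
    close-⊇ (suc k) S t = close-⊇ k _ (Equivalence.from Boolₚ.T-∨ (inj₁ t))

    private
      spread : ∀ (S : D → Bool) {d d′} → T (S d) → T ((_==ᵈ_ {G = G} (σ d) d′) ∨ (_==ᵈ_ {G = G} (flip G d) d′)) →
        T (S d′ ∨ any (λ d → S d ∧ ((_==ᵈ_ {G = G} (σ d) d′) ∨ (_==ᵈ_ {G = G} (flip G d) d′))) (darts G))
      spread S {d} {d′} t e = Equivalence.from (Boolₚ.T-∨ {S d′}) (inj₂ (Anyₚ.any⁺
        (λ d → S d ∧ ((_==ᵈ_ {G = G} (σ d) d′) ∨ (_==ᵈ_ {G = G} (flip G d) d′)))
        (lose (∈-darts d) (Equivalence.from (Boolₚ.T-∧ {S d}) (t , e)))))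

    close-complete : ∀ {j d d′} k S → j ≤ k → T (S d) → Steps j d d′ → T (close G σ k S d′)
    close-complete k S _ t start = close-⊇ k S t
    close-complete {d = d} (suc k) S (s≤s j≤k) t (rotate s) = close-complete k _ j≤k
      (spread S t (Equivalence.from (Boolₚ.T-∨ {_==ᵈ_ {G = G} (σ d) (σ d)} {_==ᵈ_ {G = G} (flip G d) (σ d)})
        (inj₁ (==ᵈ-refl (σ d))))) s
    close-complete {d = d} (suc k) S (s≤s j≤k) t (turn s) = close-complete k _ j≤k
      (spread S t (Equivalence.from (Boolₚ.T-∨ {_==ᵈ_ {G = G} (σ d) (flip G d)} {_==ᵈ_ {G = G} (flip G d) (flip G d)})
        (inj₂ (==ᵈ-refl (flip G d))))) s

    -- One reachable dart of smaller key already disqualifies a dart, so only the dart of key 0 can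
    -- be counted. Whole components need not be explored.
    compCount-≤1 : (∀ d → 0 < κ d → ∃ λ d′ → κ d′ < κ d × (∃ λ j → j ≤ 2 * m G × Steps j d d′)) →
      compCount G σ ≤ 1
    compCount-≤1 descend = countᵇ-≤ darts-unique (λ _ → zero) λ t t′ _ →
      key-injective (trans (minimal t) (sym (minimal t′)))
      where
      implied : ∀ {a b} → T (not a ∨ b) → T a → T b
      implied {true} t _ = t
      minimal : ∀ {d} → T (all (λ d′ → not (compOf G σ d d′) ∨ (κ d ≤ᵇ κ d′)) (darts G)) → κ d ≡ 0
      minimal {d} t with κ d ℕₚ.≟ 0
      ... | yes e = e
      ... | no  n with descend d (ℕₚ.n≢0⇒n>0 n)
      ...   | d′ , less , j , j≤ , s = contradiction less (ℕₚ.≤⇒≯ (ℕₚ.≤ᵇ⇒≤ _ _ (implied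
              (All.lookup (Allₚ.all⁺ _ (darts G) t) (∈-darts d′))
              (close-complete (2 * m G) _ j≤ (==ᵈ-refl d) s))))

-- Planar graphs are sparse

cardinality-≤ : ∀ {A B : Set} {a b} → A ↔ Fin a → B ↔ Fin b → (f : A → B) → Injective _≡_ _≡_ f → a ≤ b
cardinality-≤ A↔ B↔ f inj = Finₚ.injective⇒≤ {f = Inverse.to B↔ ∘ f ∘ Inverse.from A↔}
  λ e → Injection.injective (↔⇒↣ (↔-sym A↔)) (inj (Injection.injective (↔⇒↣ B↔) e))

length-filter-split : ∀ {A : Set} {P : A → Set} (P? : Decidable P) xs →
  length (filter P? xs) + length (filter (¬? ∘ P?) xs) ≡ length xs
length-filter-split P? []       = refl
length-filter-split P? (x ∷ xs) with P? x
... | yes _ = cong suc (length-filter-split P? xs)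
... | no  _ = trans (ℕₚ.+-suc _ _) (cong suc (length-filter-split P? xs))

module _ {V : Set} (G : Graph V) where
  open Darts G

  dartsOf : List (Fin (m G)) → List D
  dartsOf = concatMap (λ e → (e , false) ∷ (e , true) ∷ [])

  ∈-dartsOf : ∀ {e es} → e ∈ es → ∀ b → (e , b) ∈ dartsOf es
  ∈-dartsOf e∈ b = ∈-concatMap⁺ _ (lose e∈ (member b))
    where
    member : ∀ {e} b → (e , b) ∈ (e , false) ∷ (e , true) ∷ []
    member false = here refl
    member true  = there (here refl)

  length-dartsOf : ∀ es → length (dartsOf es) ≡ length es * 2
  length-dartsOf []       = refl
  length-dartsOf (e ∷ es) = cong (2 +_) (length-dartsOf es)

  module _ {σ : D → D} (inj : Injective _≡_ _≡_ σ) where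

    -- The pair of `d` and `flip G d` is closed under `σ` and `flip G`, and by injectivity of `σ`
    -- also backwards, so `EqClosure` cannot leave it.
    isolated-component : ∀ {d} → σ d ≡ d → σ (flip G d) ≡ flip G d →
      ∀ {x} → EqClosure (Adjacent σ) d x → x ≡ d ⊎ x ≡ flip G d
    isolated-component {d} σd σαd {x} r with x ≟ d | x ≟ flip G d
    ... | yes e  | _      = inj₁ e
    ... | no _   | yes e  = inj₂ e
    ... | no x≢d | no x≢αd = contradiction (same r) λ (f , _) → x≢both (f (inj₁ refl))
      where
      x≢both : ¬ (x ≡ d ⊎ x ≡ flip G d)
      x≢both (inj₁ e) = x≢d e
      x≢both (inj₂ e) = x≢αd e
      Here : D → Set
      Here y = y ≡ d ⊎ y ≡ flip G d
      forward : ∀ {y z} → Adjacent σ y z → Here y → Here z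
      forward (inj₁ refl) (inj₁ refl) = inj₁ σd
      forward (inj₁ refl) (inj₂ refl) = inj₂ σαd
      forward (inj₂ refl) (inj₁ refl) = inj₂ refl
      forward (inj₂ refl) (inj₂ refl) = inj₁ (flip-involutive d)
      backward : ∀ {y z} → Adjacent σ y z → Here z → Here y
      backward (inj₁ e) (inj₁ refl) = inj₁ (inj (trans e (sym σd)))
      backward (inj₁ e) (inj₂ refl) = inj₂ (inj (trans e (sym σαd)))
      backward (inj₂ e) (inj₁ refl) = inj₂ (trans (sym (flip-involutive _)) (cong (flip G) e))
      backward (inj₂ e) (inj₂ refl) = inj₁ (trans (sym (flip-involutive _)) (trans (cong (flip G) e) (flip-involutive d)))
      same : ∀ {y z} → EqClosure (Adjacent σ) y z → (Here y → Here z) × (Here z → Here y)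
      same = Eq.fold {S = λ y z → (Here y → Here z) × (Here z → Here y)} record
        { refl = id , id ; sym = swap ; trans = λ (f , g) (f′ , g′) → f′ ∘ f , g ∘ g′ }
        λ a → forward a , backward a

    isolated-≤ : ∀ {C} → Classes (Adjacent σ) C → ∀ {es} → Unique es →
      (∀ {e} → e ∈ es → ∀ b → σ (e , b) ≡ (e , b)) → length es ≤ C
    isolated-≤ P {es} u fixed = Finₚ.injective⇒≤ {f = λ i → cls P (lookup es i , false)}
      λ {i} {j} e → lookup-injective u (edge-≡ (isolated-component (fixed (∈-lookup i) false) (fixed (∈-lookup i) true)
        (complete P e)))
      where
      edge-≡ : ∀ {e e′} → (e′ , false) ≡ (e , false) ⊎ (e′ , false) ≡ (e , true) → e ≡ e′
      edge-≡ (inj₁ refl) = refl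

  -- Detaching every dart leaves the map of m isolated edges, whose genus is 0.
  euler-≤ : ∀ {σ} → Injective _≡_ _≡_ σ → ∀ {V F C} → Classes (Orb σ) V → Classes (Orb (σ ∘ flip G)) F →
    Classes (Adjacent σ) C → V + F ≤ m G + 2 * C
  euler-≤ inj cV cF cC = bound (detach inj cV cF cC (dartsOf (allFin (m G))))
   where
   bound : ∀ {σ V F C cV cF cC} → Detached σ {V} {F} {C} cV cF cC (dartsOf (allFin (m G))) → V + F ≤ m G + 2 * C
   bound {σ} {V} {F} {C} all-detached = ℕₚ.+-cancelˡ-≤ (2 * C′) _ _ (begin
    2 * C′ + (V + F)          ≤⟨ defect ⟩
    2 * C + (V′ + F′)         ≤⟨ ℕₚ.+-monoʳ-≤ (2 * C) (ℕₚ.+-mono-≤ V′≤2m F′≤C′) ⟩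
    2 * C + (m G * 2 + C′)    ≡⟨ solve 3 (λ c m c′ → con 2 :* c :+ (m :* con 2 :+ c′)
                                    := m :+ (m :+ con 2 :* c :+ c′)) refl C (m G) C′ ⟩
    m G + (m G + 2 * C + C′) ≤⟨ ℕₚ.+-monoˡ-≤ _ m≤C′ ⟩
    C′ + (m G + 2 * C + C′)  ≡⟨ solve 3 (λ c m c′ → c′ :+ (m :+ con 2 :* c :+ c′)
                                    := con 2 :* c′ :+ (m :+ con 2 :* c)) refl C (m G) C′ ⟩
    2 * C′ + (m G + 2 * C)    ∎)
    where
    open ℕₚ.≤-Reasoning
    open +-*-Solver
    open Detached all-detached
    fixed : ∀ d → σ′ d ≡ d
    fixed (e , b) = detached (∈-dartsOf (∈-allFin e) b)
    V′≤2m : V′ ≤ m G * 2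
    V′≤2m = Finₚ.injective⇒≤ {f = Inverse.to dart-fin ∘ rep vertices} λ e →
      trans (sym (cls-rep vertices _)) (trans (cong (cls vertices)
        (Injection.injective (↔⇒↣ dart-fin) e)) (cls-rep vertices _))
    F′≤C′ : F′ ≤ C′
    F′≤C′ = refinement-≤ components faces λ
      { (inj₁ e) → stay (trans (sym (fixed _)) e) ; (inj₂ refl) → step (fixed _) }
    m≤C′ : m G ≤ C′
    m≤C′ = subst (_≤ C′) (Listₚ.length-tabulate {n = m G} id) (isolated-≤ injective components
      (Uniqueₚ.allFin⁺ (m G)) λ {e} _ b → fixed (e , b))

  -- Orbits are bounded by classes from above and classes by components from below, so exactly this
  -- half of Euler's formula carries over from the Boolean counts to classes.
  planar-defect : ∀ {σ} → Injective _≡_ _≡_ σ →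
    orbitCount G σ + orbitCount G (σ ∘ flip G) ≡ m G + 2 * compCount G σ →
    ∀ {V F C} → Classes (Orb σ) V → Classes (Orb (σ ∘ flip G)) F → Classes (Adjacent σ) C →
    m G + 2 * C ≤ V + F
  planar-defect {σ} inj planar {V} {F} {C} cV cF cC = begin
    m G + 2 * C                                    ≤⟨ ℕₚ.+-monoʳ-≤ (m G) (ℕₚ.*-monoʳ-≤ 2 (compCount-≥ σ cC)) ⟩
    m G + 2 * compCount G σ                        ≡⟨ planar ⟨
    orbitCount G σ + orbitCount G (σ ∘ flip G)     ≤⟨ ℕₚ.+-mono-≤ (orbitCount-≤ inj cV) (orbitCount-≤ face-inj cF) ⟩
    V + F                                          ∎
    where
    open ℕₚ.≤-Reasoning
    face-inj : Injective _≡_ _≡_ (σ ∘ flip G)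
    face-inj e = trans (sym (flip-involutive _)) (trans (cong (flip G) (inj e)) (flip-involutive _))

Parallel : ∀ {V} (G : Graph V) → Fin (m G) → Fin (m G) → Set
Parallel G e e′ = ends G e ≡ ends G e′ ⊎ ends G e ≡ swap (ends G e′)

module _ {n : ℕ} (G : Graph (Fin n)) where
  open Darts G

  tail-flip : ∀ d → tail G (flip G d) ≡ head G d
  tail-flip (e , false) = refl
  tail-flip (e , true)  = refl

  antiparallel : ∀ d d′ → tail G d′ ≡ head G d → head G d′ ≡ tail G d → Parallel G (proj₁ d) (proj₁ d′)
  antiparallel (e , false) (e′ , false) p q = inj₂ (cong₂ _,_ (sym q) (sym p))
  antiparallel (e , false) (e′ , true)  p q = inj₁ (cong₂ _,_ (sym q) (sym p))
  antiparallel (e , true)  (e′ , false) p q = inj₁ (cong₂ _,_ (sym p) (sym q))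
  antiparallel (e , true)  (e′ , true)  p q = inj₂ (cong₂ _,_ (sym p) (sym q))

  module _ {S : Fin (m G) → Set} (S? : Decidable S)
           (loopless : ∀ {e} → S e → proj₁ (ends G e) ≢ proj₂ (ends G e))
           (simple : ∀ {e e′} → S e → S e′ → Parallel G e e′ → e ≡ e′) where

    private
      selected unselected : List (Fin (m G))
      selected   = filter S? (allFin (m G))
      unselected = filter (¬? ∘ S?) (allFin (m G))

    module Submap {σ : D → D} (inj : Injective _≡_ _≡_ σ) (tails : ∀ d → tail G (σ d) ≡ tail G d)
             (transitive : ∀ d d′ → tail G d ≡ tail G d′ → ∃ λ t → iter t σ d ≡ d′)
             {V F C : ℕ} {cV : Classes (Orb σ) V} {cF : Classes (Orb (σ ∘ flip G)) F} {cC : Classes (Adjacent σ) C}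
             (planar : m G + 2 * C ≤ V + F)
             (reduced : Detached σ cV cF cC (dartsOf G unselected)) where
      open Detached reduced

      φ : D → D
      φ = σ′ ∘ flip G

      V≤n : V ≤ n
      V≤n = Finₚ.injective⇒≤ {f = tail G ∘ rep cV} λ {c} {c′} e →
        let t , r = transitive _ _ e
        in  trans (sym (cls-rep cV c)) (trans (sound* cV (iter-orbit σ t _ ▸ stay r)) (cls-rep cV c′))

      tail-σ′ : ∀ d → tail G (σ′ d) ≡ tail G d
      tail-σ′ d = sym (≡-invariant (tail G) (λ { {x} refl → sym (tails x) }) (preserved d))

      fixed : ∀ {e} → ¬ S e → ∀ b → σ′ (e , b) ≡ (e , b)
      fixed {e} ¬s b = detached (∈-dartsOf G (∈-filter⁺ (¬? ∘ S?) (∈-allFin e) ¬s) b)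

      tail≢head : ∀ {d} → S (proj₁ d) → tail G d ≢ head G d
      tail≢head {e , false} s = loopless s
      tail≢head {e , true}  s = loopless s ∘ sym

      tail-φ : ∀ d → tail G (φ d) ≡ head G d
      tail-φ d = trans (tail-σ′ (flip G d)) (tail-flip d)

      flip≢ : ∀ d → flip G d ≢ d
      flip≢ (e , false) ()
      flip≢ (e , true)  ()

      -- A monogon on a selected edge would make it a loop; on the darts of an unselected edge, `φ`
      -- is `flip G`.
      no-monogon : ∀ d → φ d ≢ d
      no-monogon d φd≡d with S? (proj₁ d)
      ... | yes s = tail≢head {d} s (trans (cong (tail G) (sym φd≡d)) (tail-φ d))
      ... | no ¬s = flip≢ d (trans (sym (fixed ¬s _)) φd≡d)

      -- The two darts of a digon join the same ends in opposite directions, so simplicity puts them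
      -- on one edge. An unselected edge is its own digon.
      digon-flip : ∀ d → φ (φ d) ≡ d → φ d ≡ flip G d
      digon-flip d e with S? (proj₁ d)
      ... | no ¬s = fixed ¬s _
      ... | yes s with S? (proj₁ (φ d))
      ...   | no ¬s′ = contradiction (subst (S ∘ proj₁) (trans (sym e) (fixed ¬s′ _)) s) ¬s′
      ...   | yes s′ = same-edge (simple s s′ (antiparallel d (φ d) (tail-φ d)
                (trans (sym (tail-φ (φ d))) (cong (tail G) e)))) (no-monogon d)
        where
        same-edge : ∀ {d d′ : D} → proj₁ d ≡ proj₁ d′ → d′ ≢ d → d′ ≡ flip G d
        same-edge {_ , b} {_ , b′} refl n = cong (_ ,_) (Boolₚ.¬-not (n ∘ cong (_ ,_)))

      digon-isolated : ∀ d → φ (φ d) ≡ d → σ′ d ≡ d × σ′ (flip G d) ≡ flip G d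
      digon-isolated d e =
        trans (cong σ′ (trans (sym (flip-involutive d)) (cong (flip G) (sym (digon-flip d e))))) e , digon-flip d e

      -- A face has at least three darts, or is the digon around an isolated edge; the latter is charged
      -- to the component of that edge.
      third : ∀ d → Dec (φ (φ d) ≡ d) → D ⊎ Fin C′
      third d (yes _) = inj₂ (cls components d)
      third d (no _)  = inj₁ (φ (φ d))

      -- Every face claims three tokens, darts of its own or the component of an isolated edge.
      -- Injectivity of this map is the inequality `3F′ ≤ 2m + C′`.
      corner : Fin F′ × Fin 3 → D ⊎ Fin C′
      corner (c , zero)           = inj₁ (rep faces c)
      corner (c , suc zero)       = inj₁ (φ (rep faces c))
      corner (c , suc (suc zero)) = third (rep faces c) (φ (φ (rep faces c)) ≟ rep faces c)

      face-φ : ∀ d → cls faces (φ d) ≡ cls faces d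
      face-φ d = sym (sound faces refl)

      face-corner : ∀ c i {d} → corner (c , i) ≡ inj₁ d → cls faces d ≡ c
      face-corner c zero       refl = cls-rep faces c
      face-corner c (suc zero) refl = trans (face-φ _) (cls-rep faces c)
      face-corner c (suc (suc zero)) e with φ (φ (rep faces c)) ≟ rep faces c
      face-corner c (suc (suc zero)) refl | no _ = trans (face-φ _) (trans (face-φ _) (cls-rep faces c))

      component-corner : ∀ c i {k} → corner (c , i) ≡ inj₂ k → i ≡ suc (suc zero) ×
        φ (φ (rep faces c)) ≡ rep faces c × cls components (rep faces c) ≡ k
      component-corner c (suc (suc zero)) e with φ (φ (rep faces c)) ≟ rep faces c
      component-corner c (suc (suc zero)) refl | yes digon = refl , digon , refl

      corner-distinct : ∀ c i j {d} → corner (c , i) ≡ inj₁ d → corner (c , j) ≡ inj₁ d → i ≡ j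
      corner-distinct c zero zero _ _ = refl
      corner-distinct c (suc zero) (suc zero) _ _ = refl
      corner-distinct c (suc (suc zero)) (suc (suc zero)) _ _ = refl
      corner-distinct c zero (suc zero) refl e = contradiction (Sumₚ.inj₁-injective e) (no-monogon _)
      corner-distinct c (suc zero) zero e refl = contradiction (Sumₚ.inj₁-injective e) (no-monogon _)
      corner-distinct c zero (suc (suc zero)) refl e with φ (φ (rep faces c)) ≟ rep faces c
      ... | no n = contradiction (Sumₚ.inj₁-injective e) n
      corner-distinct c (suc (suc zero)) zero e refl with φ (φ (rep faces c)) ≟ rep faces c
      ... | no n = contradiction (Sumₚ.inj₁-injective e) n
      corner-distinct c (suc zero) (suc (suc zero)) refl e with φ (φ (rep faces c)) ≟ rep faces c
      ... | no n = contradiction (Sumₚ.inj₁-injective e) (no-monogon _)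
      corner-distinct c (suc (suc zero)) (suc zero) e refl with φ (φ (rep faces c)) ≟ rep faces c
      ... | no n = contradiction (Sumₚ.inj₁-injective e) (no-monogon _)

      corner-injective : Injective _≡_ _≡_ corner
      corner-injective {c , i} {c′ , j} e with corner (c , i) in p | corner (c′ , j) in q
      corner-injective {c , i} {c′ , j} refl | inj₁ d | inj₁ d
        with refl ← trans (sym (face-corner c i p)) (face-corner c′ j q) = cong (c ,_) (corner-distinct c i j p q)
      corner-injective {c , i} {c′ , j} refl | inj₂ k | inj₂ k
        with component-corner c i p | component-corner c′ j q
      ... | refl , digon , k≡ | refl , _ , k≡′ = cong (_, _)
            (trans (sym (cls-rep faces c)) (trans (sym same-face) (cls-rep faces c′)))
        where
        -- An isolated edge has a single face, its digon, so no component is charged twice.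
        same-face : cls faces (rep faces c′) ≡ cls faces (rep faces c)
        same-face with isolated-component G injective (proj₁ (digon-isolated _ digon)) (proj₂ (digon-isolated _ digon))
                         (complete components (trans k≡ (sym k≡′)))
        ... | inj₁ e = cong (cls faces) e
        ... | inj₂ e = trans (cong (cls faces) (trans e (sym (digon-flip _ digon)))) (face-φ _)

      faces-≤ : F′ * 3 ≤ m G * 2 + C′
      faces-≤ = cardinality-≤ (↔-sym (Finₚ.*↔× {F′} {3})) (↔-trans (dart-fin ⊎-↔ ↔-refl) (↔-sym (Finₚ.+↔⊎ {m G * 2} {C′})))
        corner corner-injective

      r : ℕ
      r = length unselected

      r≤C′ : r ≤ C′
      r≤C′ = isolated-≤ G injective components (Uniqueₚ.filter⁺ (¬? ∘ S?) (Uniqueₚ.allFin⁺ (m G)))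
        λ i b → fixed (proj₂ (∈-filter⁻ (¬? ∘ S?) {xs = allFin (m G)} i)) b

      s+r≡m : length selected + r ≡ m G
      s+r≡m = trans (length-filter-split S? (allFin (m G))) (Listₚ.length-tabulate {n = m G} id)

      -- Planarity survives the reduction: `m G` is unchanged, and adding `planar` to `defect` lets
      -- `V`, `F` and `2 * C` drop out.
      euler : m G + 2 * C′ ≤ V′ + F′
      euler = ℕₚ.+-cancelˡ-≤ (2 * C) _ _ (begin
        2 * C + (m G + 2 * C′) ≡⟨ solve 3 (λ c m c′ → con 2 :* c :+ (m :+ con 2 :* c′)
                                     := con 2 :* c′ :+ (m :+ con 2 :* c)) refl C (m G) C′ ⟩
        2 * C′ + (m G + 2 * C) ≤⟨ ℕₚ.+-monoʳ-≤ (2 * C′) planar ⟩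
        2 * C′ + (V + F)       ≤⟨ defect ⟩
        2 * C + (V′ + F′)      ∎)
        where
        open ℕₚ.≤-Reasoning
        open +-*-Solver

      -- The usual count behind `m ≤ 3n`, with the `r` unselected edges still present as isolated
      -- ones. They bring `6r` through `V′ ≤ n + 2r`: five of these are absorbed by `5C′` since
      -- `r ≤ C′`, and the sixth turns `m` into the number of selected edges.
      detached-simple-≤ : length selected ≤ 3 * n
      detached-simple-≤ = ℕₚ.+-cancelʳ-≤ (r + (2 * m G + 6 * C′)) _ _ (begin
        s + (r + (2 * m G + 6 * C′))
          ≡⟨ trans (sym (ℕₚ.+-assoc s r _)) (cong (_+ (2 * m G + 6 * C′)) s+r≡m) ⟩
        m G + (2 * m G + 6 * C′)
          ≡⟨ solve 2 (λ m c → m :+ (con 2 :* m :+ con 6 :* c) := con 3 :* (m :+ con 2 :* c)) refl (m G) C′ ⟩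
        3 * (m G + 2 * C′)
          ≤⟨ ℕₚ.*-monoʳ-≤ 3 euler ⟩
        3 * (V′ + F′)
          ≡⟨ solve 2 (λ v f → con 3 :* (v :+ f) := con 3 :* v :+ f :* con 3) refl V′ F′ ⟩
        3 * V′ + F′ * 3
          ≤⟨ ℕₚ.+-mono-≤ (ℕₚ.*-monoʳ-≤ 3 V′≤n+2r) faces-≤ ⟩
        3 * (n + r * 2) + (m G * 2 + C′)
          ≡⟨ solve 4 (λ n r m c → con 3 :* (n :+ r :* con 2) :+ (m :* con 2 :+ c)
               := con 5 :* r :+ (con 3 :* n :+ r :+ con 2 :* m :+ c)) refl n r (m G) C′ ⟩
        5 * r + (3 * n + r + 2 * m G + C′)
          ≤⟨ ℕₚ.+-monoˡ-≤ _ (ℕₚ.*-monoʳ-≤ 5 r≤C′) ⟩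
        5 * C′ + (3 * n + r + 2 * m G + C′)
          ≡⟨ solve 4 (λ n r m c → con 5 :* c :+ (con 3 :* n :+ r :+ con 2 :* m :+ c)
               := con 3 :* n :+ (r :+ (con 2 :* m :+ con 6 :* c))) refl n r (m G) C′ ⟩
        3 * n + (r + (2 * m G + 6 * C′)) ∎)
        where
        open ℕₚ.≤-Reasoning
        open +-*-Solver
        s : ℕ
        s = length selected
        V′≤n+2r : V′ ≤ n + r * 2
        V′≤n+2r = ℕₚ.≤-trans V′≤ (ℕₚ.+-mono-≤ V≤n (ℕₚ.≤-reflexive (length-dartsOf G unselected)))

    planar-simple-≤ : Planar G → length selected ≤ 3 * n
    planar-simple-≤ (σ , (inj , tails , transitive) , planar) =
      Submap.detached-simple-≤ inj tails transitive (planar-defect G inj planar cV cF cC)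
        (detach inj cV cF cC (dartsOf G unselected))
      where
      cV = proj₂ (∃-orbits σ)
      cF = proj₂ (∃-orbits (σ ∘ flip G))
      cC = proj₂ (∃-components σ)

-- Keeping the lightest edge between each pair of adjacent vertices

walk-of : ∀ {V} (G : Graph V) {u v w} (d : Dart G) → tail G d ≡ u → head G d ≡ v →
  (p : Walk G v w) → ∃ λ (q : Walk G u w) → walkLen q ≡ len G (proj₁ d) ℚ.+ walkLen p
walk-of G d refl refl p = cons d p , refl

module _ {V : Set} (G : Graph V) where

  parallel-refl : ∀ {e} → Parallel G e e
  parallel-refl = inj₁ refl

  parallel-sym : ∀ {e e′} → Parallel G e e′ → Parallel G e′ e
  parallel-sym (inj₁ p) = inj₁ (sym p)
  parallel-sym (inj₂ p) = inj₂ (sym (cong swap p))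

  parallel-trans : ∀ {e e′ e″} → Parallel G e e′ → Parallel G e′ e″ → Parallel G e e″
  parallel-trans (inj₁ p) (inj₁ q) = inj₁ (trans p q)
  parallel-trans (inj₁ p) (inj₂ q) = inj₂ (trans p q)
  parallel-trans (inj₂ p) (inj₁ q) = inj₂ (trans p (cong swap q))
  parallel-trans (inj₂ p) (inj₂ q) = inj₁ (trans p (cong swap q))

  parallel-dart : ∀ {e} (d : Dart G) → Parallel G e (proj₁ d) →
    ∃ λ b → tail G (e , b) ≡ tail G d × head G (e , b) ≡ head G d
  parallel-dart (_ , false) (inj₁ p) = false , cong proj₁ p , cong proj₂ p
  parallel-dart (_ , false) (inj₂ p) = true  , cong proj₂ p , cong proj₁ p
  parallel-dart (_ , true)  (inj₁ p) = true  , cong proj₂ p , cong proj₁ p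
  parallel-dart (_ , true)  (inj₂ p) = false , cong proj₁ p , cong proj₂ p

  subgraph : List (Fin (m G)) → Graph V
  subgraph es = record { m = length es ; ends = ends G ∘ lookup es ; len = len G ∘ lookup es }

  subgraph-tail : ∀ es (d : Dart (subgraph es)) → tail (subgraph es) d ≡ tail G (lookup es (proj₁ d) , proj₂ d)
  subgraph-tail es (i , false) = refl
  subgraph-tail es (i , true)  = refl

  subgraph-head : ∀ es (d : Dart (subgraph es)) → head (subgraph es) d ≡ head G (lookup es (proj₁ d) , proj₂ d)
  subgraph-head es (i , false) = refl
  subgraph-head es (i , true)  = refl

  subgraph-walk : ∀ es {u v} (p : Walk (subgraph es) u v) → ∃ λ (q : Walk G u v) → walkLen q ≡ walkLen p
  subgraph-walk es nil = nil , refl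
  subgraph-walk es (cons (i , b) p) with subgraph-walk es p
  ... | q , e with walk-of G (lookup es i , b) (sym (subgraph-tail es (i , b))) (sym (subgraph-head es (i , b))) q
  ...   | q′ , e′ = q′ , trans e′ (cong (len G (lookup es i) ℚ.+_) e)

module _ {n : ℕ} (G : Graph (Fin n)) (nonNeg : NonNeg G) (es : List (Fin (m G)))
         (covers : ∀ e → proj₁ (ends G e) ≢ proj₂ (ends G e) →
           ∃ λ r → r ∈ es × Parallel G r e × len G r ℚ.≤ len G e) where

  private
    K : Graph (Fin n)
    K = subgraph G es

    loop : ∀ d → proj₁ (ends G (proj₁ d)) ≡ proj₂ (ends G (proj₁ d)) → tail G d ≡ head G d
    loop (e , false) q = q
    loop (e , true)  q = sym q

    step-walk : ∀ d {v} → tail G d ≢ head G d → (q : Walk K (head G d) v) →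
      ∃ λ (q′ : Walk K (tail G d) v) → walkLen q′ ℚ.≤ len G (proj₁ d) ℚ.+ walkLen q
    step-walk d noloop q with covers (proj₁ d) (noloop ∘ loop d)
    ... | r , i , parallel , r≤d with parallel-dart G d parallel
    ...   | b , t , h with walk-of K (Any.index i , b)
              (trans (subgraph-tail G es (Any.index i , b)) (trans (cong (λ x → tail G (x , b)) (sym (Anyₚ.lookup-index i))) t))
              (trans (subgraph-head G es (Any.index i , b)) (trans (cong (λ x → head G (x , b)) (sym (Anyₚ.lookup-index i))) h)) q
    ...     | q′ , e = q′ , ℚₚ.≤-trans (ℚₚ.≤-reflexive e)
                (ℚₚ.+-monoˡ-≤ (walkLen q) (subst (λ x → len G x ℚ.≤ len G (proj₁ d)) (Anyₚ.lookup-index i) r≤d))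

  -- Each step is replaced by its representative in `es`. A loop need not have one and is skipped,
  -- which cannot lengthen the walk because lengths are nonnegative.
  covering-walk : ∀ {u v} (p : Walk G u v) → ∃ λ (q : Walk K u v) → walkLen q ℚ.≤ walkLen p
  covering-walk nil = nil , ℚₚ.≤-refl
  covering-walk {v = v} (cons d p) = extend-by (covering-walk p) (tail G d Finₚ.≟ head G d)
    where
    Short : Fin n → ℚ → Set
    Short u x = ∃ λ (q : Walk K u v) → walkLen q ℚ.≤ x
    extend-by : Short (head G d) (walkLen p) → Dec (tail G d ≡ head G d) →
      Short (tail G d) (len G (proj₁ d) ℚ.+ walkLen p)
    extend-by (q , q≤p) (no noloop) =
      let q′ , q′≤ = step-walk d noloop q in q′ , ℚₚ.≤-trans q′≤ (ℚₚ.+-monoʳ-≤ (len G (proj₁ d)) q≤p)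
    extend-by (q , q≤p) (yes e) = subst (λ u → Short u (len G (proj₁ d) ℚ.+ walkLen p)) (sym e)
      (q , ℚₚ.≤-trans (ℚₚ.≤-reflexive (sym (ℚₚ.+-identityˡ _))) (ℚₚ.+-mono-≤ (nonNeg (proj₁ d)) q≤p))

  covering-dist : ∀ {u v x} → IsDist G u v x → IsDist K u v x
  covering-dist {u} {v} {x} ((p , p≡x) , minimal) =
    let q , q≤p = covering-walk p
    in  (q , ℚₚ.≤-antisym (ℚₚ.≤-trans q≤p (ℚₚ.≤-reflexive p≡x)) (minimal′ q)) , minimal′
    where
    minimal′ : ∀ (q : Walk K u v) → x ℚ.≤ walkLen q
    minimal′ q = let p′ , e = subgraph-walk G es q in ℚₚ.≤-trans (minimal p′) (ℚₚ.≤-reflexive e)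

module Lightest {n : ℕ} (G : Graph (Fin n)) where

  -- Ties between equally long parallel edges are broken by the index. Antisymmetry then makes
  -- `lightest` a function of the parallel class alone, so one edge per class is kept.
  order : TotalOrder _ _ _
  order = ×-totalOrder ℚₚ.≤-decTotalOrder (Finₚ.≤-totalOrder (m G))

  open TotalOrder order using () renaming (_≤_ to _≼_; antisym to ≼-antisym)
  open Extrema order using (argmin; argmin-all; f[argmin]≤f[xs])

  weight : Fin (m G) → ℚ × Fin (m G)
  weight e = len G e , e

  parallel? : ∀ e → Decidable (λ e′ → Parallel G e′ e)
  parallel? e e′ = ends-≟ (ends G e′) (ends G e) ⊎-dec ends-≟ (ends G e′) (swap (ends G e))
    where ends-≟ = Productₚ.≡-dec Finₚ._≟_ Finₚ._≟_

  lightest : Fin (m G) → Fin (m G)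
  lightest e = argmin weight e (filter (parallel? e) (allFin (m G)))

  lightest-parallel : ∀ e → Parallel G (lightest e) e
  lightest-parallel e = argmin-all weight {P = λ x → Parallel G x e} (parallel-refl G)
    (All.tabulate λ i → proj₂ (∈-filter⁻ (parallel? e) {xs = allFin (m G)} i))

  lightest-≼ : ∀ {e e′} → Parallel G e′ e → weight (lightest e) ≼ weight e′
  lightest-≼ {e} p = All.lookup (f[argmin]≤f[xs] {f = weight} e (filter (parallel? e) (allFin (m G))))
    (∈-filter⁺ (parallel? e) (∈-allFin _) p)

  lightest-≤ : ∀ e → len G (lightest e) ℚ.≤ len G e
  lightest-≤ e = ≼⇒≤ (lightest-≼ (parallel-refl G {e}))
    where
    ≼⇒≤ : ∀ {e e′} → weight e ≼ weight e′ → len G e ℚ.≤ len G e′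
    ≼⇒≤ (inj₁ (le , _)) = le
    ≼⇒≤ (inj₂ (eq , _)) = ℚₚ.≤-reflexive eq

  lightest-cong : ∀ {e e′} → Parallel G e e′ → lightest e ≡ lightest e′
  lightest-cong {e} {e′} p = proj₂ (≼-antisym
    (lightest-≼ (parallel-trans G (lightest-parallel e′) (parallel-sym G p)))
    (lightest-≼ (parallel-trans G (lightest-parallel e) p)))

  Kept : Fin (m G) → Set
  Kept e = proj₁ (ends G e) ≢ proj₂ (ends G e) × lightest e ≡ e

  kept? : Decidable Kept
  kept? e = ¬? (proj₁ (ends G e) Finₚ.≟ proj₂ (ends G e)) ×-dec (lightest e Finₚ.≟ e)

  kept : List (Fin (m G))
  kept = filter kept? (allFin (m G))

  kept-≤ : Planar G → length kept ≤ 3 * n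
  kept-≤ = planar-simple-≤ G kept? proj₁ λ (_ , l) (_ , l′) p → trans (sym l) (trans (lightest-cong p) l′)

  lightest-kept : ∀ e → proj₁ (ends G e) ≢ proj₂ (ends G e) → lightest e ∈ kept
  lightest-kept e ≢ends = ∈-filter⁺ kept? (∈-allFin _)
    (≢ends ∘ same-ends (lightest-parallel e) , lightest-cong (lightest-parallel e))
    where
    same-ends : ∀ {e e′} → Parallel G e e′ → proj₁ (ends G e) ≡ proj₂ (ends G e) → proj₁ (ends G e′) ≡ proj₂ (ends G e′)
    same-ends (inj₁ p) q = trans (sym (cong proj₁ p)) (trans q (cong proj₂ p))
    same-ends (inj₂ p) q = trans (sym (cong proj₂ p)) (trans (sym q) (cong proj₁ p))

planar-sparsify : ∀ {n} (H : Graph (Fin n)) → NonNeg H → Planar H →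
  ∃ λ (K : Graph (Fin n)) → m K ≤ 3 * n × NonNeg K × (∀ {u v x} → IsDist H u v x → IsDist K u v x)
planar-sparsify H nonNeg planar = subgraph H kept , kept-≤ planar , (λ i → nonNeg (lookup kept i)) ,
  covering-dist H nonNeg kept λ e ≢ends → lightest e , lightest-kept e ≢ends , lightest-parallel e , lightest-≤ e
  where open Lightest H

-- Shortest walks and edge multiplicities

-- `ℕ→ℚ` reduces its fraction by a gcd, which blocks computation on variables. The unnormalised form
-- has denominator 1, so the facts below become facts about integers.
toℚᵘ-ℕ→ℚ : ∀ n → ℚ.toℚᵘ (ℕ→ℚ n) ℚᵘ.≃ mkℚᵘ (ℤ.+ n) 0
toℚᵘ-ℕ→ℚ n = ℚₚ.toℚᵘ-fromℚᵘ (mkℚᵘ (ℤ.+ n) 0)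

ℕ→ℚ-+ : ∀ a b → ℕ→ℚ (a + b) ≡ ℕ→ℚ a ℚ.+ ℕ→ℚ b
ℕ→ℚ-+ a b = ℚₚ.toℚᵘ-injective (begin
  ℚ.toℚᵘ (ℕ→ℚ (a + b))                  ≈⟨ toℚᵘ-ℕ→ℚ (a + b) ⟩
  mkℚᵘ (ℤ.+ (a + b)) 0                    ≈⟨ *≡* (cong₂ (λ x y → (x ℤ.+ y) ℤ.* ℤ.1ℤ)
                                             (sym (ℤₚ.*-identityʳ (ℤ.+ a))) (sym (ℤₚ.*-identityʳ (ℤ.+ b)))) ⟩
  mkℚᵘ (ℤ.+ a) 0 ℚᵘ.+ mkℚᵘ (ℤ.+ b) 0         ≈⟨ ℚᵘₚ.+-cong (toℚᵘ-ℕ→ℚ a) (toℚᵘ-ℕ→ℚ b) ⟨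
  ℚ.toℚᵘ (ℕ→ℚ a) ℚᵘ.+ ℚ.toℚᵘ (ℕ→ℚ b)     ≈⟨ ℚₚ.toℚᵘ-homo-+ (ℕ→ℚ a) (ℕ→ℚ b) ⟨
  ℚ.toℚᵘ (ℕ→ℚ a ℚ.+ ℕ→ℚ b)               ∎)
  where open ℚᵘₚ.≃-Reasoning

ℕ→ℚ-mono-≤ : ∀ {a b} → a ≤ b → ℕ→ℚ a ℚ.≤ ℕ→ℚ b
ℕ→ℚ-mono-≤ {a} {b} a≤b = ℚₚ.toℚᵘ-cancel-≤ (begin
  ℚ.toℚᵘ (ℕ→ℚ a)  ≃⟨ toℚᵘ-ℕ→ℚ a ⟩
  mkℚᵘ (ℤ.+ a) 0    ≤⟨ *≤* (ℤₚ.*-monoʳ-≤-nonNeg ℤ.1ℤ (ℤ.+≤+ a≤b)) ⟩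
  mkℚᵘ (ℤ.+ b) 0    ≃⟨ toℚᵘ-ℕ→ℚ b ⟨
  ℚ.toℚᵘ (ℕ→ℚ b)  ∎)
  where open ℚᵘₚ.≤-Reasoning

ℕ→ℚ-cancel-≤ : ∀ {a b} → ℕ→ℚ a ℚ.≤ ℕ→ℚ b → a ≤ b
ℕ→ℚ-cancel-≤ {a} {b} le = cancel (begin
  mkℚᵘ (ℤ.+ a) 0    ≃⟨ toℚᵘ-ℕ→ℚ a ⟨
  ℚ.toℚᵘ (ℕ→ℚ a)  ≤⟨ ℚₚ.toℚᵘ-mono-≤ le ⟩
  ℚ.toℚᵘ (ℕ→ℚ b)  ≃⟨ toℚᵘ-ℕ→ℚ b ⟩
  mkℚᵘ (ℤ.+ b) 0    ∎)
  where
  open ℚᵘₚ.≤-Reasoning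
  cancel : mkℚᵘ (ℤ.+ a) 0 ℚᵘ.≤ mkℚᵘ (ℤ.+ b) 0 → a ≤ b
  cancel (*≤* le) = ℤₚ.drop‿+≤+ (subst₂ ℤ._≤_ (ℤₚ.*-identityʳ (ℤ.+ a)) (ℤₚ.*-identityʳ (ℤ.+ b)) le)

ℕ→ℚ-injective : Injective _≡_ _≡_ ℕ→ℚ
ℕ→ℚ-injective e = ℕₚ.≤-antisym (ℕ→ℚ-cancel-≤ (ℚₚ.≤-reflexive e)) (ℕ→ℚ-cancel-≤ (ℚₚ.≤-reflexive (sym e)))

·-ℕ→ℚ : ∀ y d → y · ℕ→ℚ d ≡ ℕ→ℚ (y * d)
·-ℕ→ℚ zero    d = refl
·-ℕ→ℚ (suc y) d = trans (cong (ℕ→ℚ d ℚ.+_) (·-ℕ→ℚ y d)) (sym (ℕ→ℚ-+ d (y * d)))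

module _ {V : Set} {G : Graph V} where

  steps : ∀ {u v} → Walk G u v → ℕ
  steps nil        = 0
  steps (cons _ p) = suc (steps p)

  visits : ∀ {u v} → Walk G u v → List V
  visits {u} nil    = u ∷ []
  visits (cons d p) = tail G d ∷ visits p

  length-visits : ∀ {u v} (p : Walk G u v) → length (visits p) ≡ suc (steps p)
  length-visits nil        = refl
  length-visits (cons _ p) = cong suc (length-visits p)

module _ {n : ℕ} (G : Graph (Fin n)) (nonNeg : NonNeg G) where
  open DecMembership (Finₚ._≟_ {n}) using (_∈?_)

  Simple : ∀ {u v} → Walk G u v → Set
  Simple p = Unique (visits p)

  suffix-≤ : ∀ {x} d → x ℚ.≤ len G d ℚ.+ x
  suffix-≤ {x} d = ℚₚ.≤-trans (ℚₚ.≤-reflexive (sym (ℚₚ.+-identityˡ x))) (ℚₚ.+-monoˡ-≤ x (nonNeg d))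

  suffix : ∀ {u v w} (p : Walk G u v) → Simple p → w ∈ visits p →
    ∃ λ (q : Walk G w v) → Simple q × walkLen q ℚ.≤ walkLen p
  suffix nil        s       (here refl) = nil , s , ℚₚ.≤-refl
  suffix (cons d p) s       (here refl) = cons d p , s , ℚₚ.≤-refl
  suffix (cons d p) (_ ∷ s) (there i)   =
    let q , s′ , q≤p = suffix p s i in q , s′ , ℚₚ.≤-trans q≤p (suffix-≤ (proj₁ d))

  -- Removing closed subwalks does not lengthen a walk and leaves at most `n` steps. This is what
  -- bounds the edge multiplicities later.
  loop-erase : ∀ {u v} (p : Walk G u v) → ∃ λ (q : Walk G u v) → Simple q × walkLen q ℚ.≤ walkLen p
  loop-erase nil        = nil , [] ∷ [] , ℚₚ.≤-refl
  loop-erase {v = v} (cons d p) with loop-erase p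
  ... | q , s , q≤p with tail G d ∈? visits q
  ...   | yes i = let q′ , s′ , q′≤q = suffix q s i in
                  q′ , s′ , ℚₚ.≤-trans q′≤q (ℚₚ.≤-trans q≤p (suffix-≤ (proj₁ d)))
  ...   | no ∉q = cons d q , Allₚ.¬Any⇒All¬ _ ∉q ∷ s , ℚₚ.+-monoʳ-≤ (len G (proj₁ d)) q≤p

  simple-steps-≤ : ∀ {u v} (p : Walk G u v) → Simple p → steps p ≤ n
  simple-steps-≤ p s = ℕₚ.<⇒≤ (subst (_≤ n) (length-visits p) (Finₚ.injective⇒≤ (lookup-injective s)))

  shortest-walk : ∀ {u v x} → IsDist G u v x → ∃ λ (p : Walk G u v) → walkLen p ≡ x × steps p ≤ n
  shortest-walk ((p , p≡x) , minimal) =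
    let q , s , q≤p = loop-erase p
    in  q , ℚₚ.≤-antisym (ℚₚ.≤-trans q≤p (ℚₚ.≤-reflexive p≡x)) (minimal q) , simple-steps-≤ q s

-- Length as a linear function of edge multiplicities

module _ {V : Set} (G : Graph V) where

  private
    E : Set
    E = Fin (m G)

  total : (E → ℕ) → ℚ
  total c = sum (λ e → c e · len G e)

  total-+ : ∀ c c′ → total (λ e → c e + c′ e) ≡ total c ℚ.+ total c′
  total-+ c c′ = trans (sum-cong-≗ λ e → ×-homo-+ (len G e) (c e) (c′ e))
    (∑-distrib-+ (λ e → c e · len G e) (λ e → c′ e · len G e))

  total-0 : total (λ _ → 0) ≡ 0ℚ
  total-0 = sum-replicate-zero (m G)

  total-* : ∀ y c → total (λ e → y * c e) ≡ y · total c
  total-* zero    c = total-0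
  total-* (suc y) c = trans (total-+ c (λ e → y * c e)) (cong (total c ℚ.+_) (total-* y c))

  δ : ∀ {k} → Fin k → Fin k → ℕ
  δ zero    zero    = 1
  δ zero    (suc _) = 0
  δ (suc _) zero    = 0
  δ (suc i) (suc j) = δ i j

  δ≤1 : ∀ {k} (i j : Fin k) → δ i j ≤ 1
  δ≤1 zero    zero    = ℕₚ.≤-refl
  δ≤1 zero    (suc _) = z≤n
  δ≤1 (suc _) zero    = z≤n
  δ≤1 (suc i) (suc j) = δ≤1 i j

  sum-δ : ∀ {k} (i : Fin k) (x : Fin k → ℚ) → sum (λ j → δ i j · x j) ≡ x i
  sum-δ {suc k} zero    x = trans (cong₂ ℚ._+_ (×-homo-1 (x zero)) (sum-replicate-zero k)) (ℚₚ.+-identityʳ _)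
  sum-δ {suc k} (suc i) x = trans (ℚₚ.+-identityˡ _) (sum-δ i (x ∘ suc))

  uses : ∀ {u v} → Walk G u v → E → ℕ
  uses nil        e = 0
  uses (cons d p) e = δ (proj₁ d) e + uses p e

  uses-≤ : ∀ {u v} (p : Walk G u v) e → uses p e ≤ steps p
  uses-≤ nil        e = z≤n
  uses-≤ (cons d p) e = ℕₚ.+-mono-≤ (δ≤1 (proj₁ d) e) (uses-≤ p e)

  total-uses : ∀ {u v} (p : Walk G u v) → total (uses p) ≡ walkLen p
  total-uses nil        = total-0
  total-uses (cons d p) = trans (total-+ (δ (proj₁ d)) (uses p))
    (cong₂ ℚ._+_ (sum-δ (proj₁ d) (len G)) (total-uses p))

  -- Linearity of length in the multiplicities. Single edges may have any rational length; only the
  -- totals of the given multisets are natural numbers.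
  total-combination : ∀ {N} (y : Fin N → ℕ) (c : Fin N → E → ℕ) (d : Fin N → ℕ) →
    (∀ p → total (c p) ≡ ℕ→ℚ (d p)) →
    total (λ e → sumℕ (λ p → y p * c p e)) ≡ ℕ→ℚ (sumℕ (λ p → y p * d p))
  total-combination {zero}  y c d eq = total-0
  total-combination {suc N} y c d eq = begin
    total (λ e → y zero * c zero e + sumℕ (λ p → y (suc p) * c (suc p) e))
      ≡⟨ total-+ (λ e → y zero * c zero e) _ ⟩
    total (λ e → y zero * c zero e) ℚ.+ total (λ e → sumℕ (λ p → y (suc p) * c (suc p) e))
      ≡⟨ cong₂ ℚ._+_ (trans (total-* (y zero) (c zero)) (trans (cong (y zero ·_) (eq zero)) (·-ℕ→ℚ (y zero) (d zero))))
           (total-combination (y ∘ suc) (c ∘ suc) (d ∘ suc) (eq ∘ suc)) ⟩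
    ℕ→ℚ (y zero * d zero) ℚ.+ ℕ→ℚ (sumℕ (λ p → y (suc p) * d (suc p)))
      ≡⟨ ℕ→ℚ-+ (y zero * d zero) _ ⟨
    ℕ→ℚ (y zero * d zero + sumℕ (λ p → y (suc p) * d (suc p))) ∎
    where open ≡-Reasoning

sumℕ-≤ : ∀ {N B} (f : Fin N → ℕ) → (∀ p → f p ≤ B) → sumℕ f ≤ N * B
sumℕ-≤ {zero}  f f≤ = z≤n
sumℕ-≤ {suc N} f f≤ = ℕₚ.+-mono-≤ (f≤ zero) (sumℕ-≤ (f ∘ suc) (f≤ ∘ suc))

-- The place value of digit `p` in base `b`, most significant digit first, which is the order in
-- which `funToFin` encodes.
place : ℕ → ∀ {N} → Fin N → ℕ
place b {N} p = b ^ (N ∸ suc (toℕ p))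

toℕ-funToFin : ∀ {N b} (y : Fin N → Fin b) → toℕ (funToFin y) ≡ sumℕ (λ p → toℕ (y p) * place b p)
toℕ-funToFin {zero}      y = refl
toℕ-funToFin {suc N} {b} y = trans (Finₚ.toℕ-combine (y zero) (funToFin (y ∘ suc)))
  (cong₂ _+_ (ℕₚ.*-comm (b ^ N) (toℕ (y zero))) (toℕ-funToFin (y ∘ suc)))

funToFin-injective : ∀ {k K} {f g : Fin k → Fin K} → funToFin f ≡ funToFin g → ∀ i → f i ≡ g i
funToFin-injective {f = f} {g} e i = trans (sym (Finₚ.finToFun-funToFin f i))
  (trans (cong (λ x → finToFun x i) e) (Finₚ.finToFun-funToFin g i))

-- The digits of x < b ^ N can be read off from the edge multiplicities of the union of
-- y p copies of the two walks of every pair p, which take few values.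
distance-digits-≤ : ∀ {n} (G : Graph (Fin n)) → NonNeg G → ∀ b {N} (d⁺ d⁻ : Fin N → ℕ) →
  (∀ p → d⁺ p ≡ place b p + d⁻ p) →
  (∀ p → ∃ λ u → ∃ λ v → IsDist G u v (ℕ→ℚ (d⁺ p))) →
  (∀ p → ∃ λ u → ∃ λ v → IsDist G u v (ℕ→ℚ (d⁻ p))) →
  b ^ N ≤ suc (N * (b * n)) ^ m G * suc (N * (b * n)) ^ m G
distance-digits-≤ {n} G nonNeg b {N} d⁺ d⁻ d⁺≡ dist⁺ dist⁻ = Finₚ.injective⇒≤ {f = code} code-injective
  where
  K : ℕ
  K = suc (N * (b * n))

  module Multiplicities (d : Fin N → ℕ) (dist : ∀ p → ∃ λ u → ∃ λ v → IsDist G u v (ℕ→ℚ (d p))) where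
    walk : ∀ p → Walk G (proj₁ (dist p)) (proj₁ (proj₂ (dist p)))
    walk p = proj₁ (shortest-walk G nonNeg (proj₂ (proj₂ (dist p))))
    walk-len : ∀ p → walkLen (walk p) ≡ ℕ→ℚ (d p)
    walk-len p = proj₁ (proj₂ (shortest-walk G nonNeg (proj₂ (proj₂ (dist p)))))
    walk-steps : ∀ p → steps (walk p) ≤ n
    walk-steps p = proj₂ (proj₂ (shortest-walk G nonNeg (proj₂ (proj₂ (dist p)))))

    mult : (Fin N → Fin b) → Fin (m G) → ℕ
    mult y e = sumℕ (λ p → toℕ (y p) * uses G (walk p) e)
    mult-< : ∀ y e → mult y e < K
    mult-< y e = s≤s (sumℕ-≤ _ λ p →
      ℕₚ.*-mono-≤ (ℕₚ.<⇒≤ (Finₚ.toℕ<n (y p))) (ℕₚ.≤-trans (uses-≤ G (walk p) e) (walk-steps p)))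
    multFin : (Fin N → Fin b) → Fin (m G) → Fin K
    multFin y e = fromℕ< (mult-< y e)

    combination-cong : ∀ y y′ → funToFin (multFin y) ≡ funToFin (multFin y′) →
      sumℕ (λ p → toℕ (y p) * d p) ≡ sumℕ (λ p → toℕ (y′ p) * d p)
    combination-cong y y′ eq = ℕ→ℚ-injective (begin
      ℕ→ℚ (sumℕ (λ p → toℕ (y p) * d p))   ≡⟨ total-combination G (toℕ ∘ y) (uses G ∘ walk) d totals ⟨
      total G (mult y)                     ≡⟨ sum-cong-≗ (λ e → cong (_· len G e) (same e)) ⟩
      total G (mult y′)                    ≡⟨ total-combination G (toℕ ∘ y′) (uses G ∘ walk) d totals ⟩
      ℕ→ℚ (sumℕ (λ p → toℕ (y′ p) * d p))  ∎)
      where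
      open ≡-Reasoning
      totals : ∀ p → total G (uses G (walk p)) ≡ ℕ→ℚ (d p)
      totals p = trans (total-uses G (walk p)) (walk-len p)
      same : ∀ e → mult y e ≡ mult y′ e
      same e = trans (sym (Finₚ.toℕ-fromℕ< (mult-< y e)))
        (trans (cong toℕ (funToFin-injective eq e)) (Finₚ.toℕ-fromℕ< (mult-< y′ e)))

  module M⁺ = Multiplicities d⁺ dist⁺
  module M⁻ = Multiplicities d⁻ dist⁻

  code : Fin (b ^ N) → Fin (K ^ m G * K ^ m G)
  -- A place value is the difference of a `d⁺` and a `d⁻`, so the multiplicities of both families
  -- are recorded; this causes the two equal factors in the bound.
  code x = combine (funToFin (M⁺.multFin (finToFun x))) (funToFin (M⁻.multFin (finToFun x)))

  weighted : (Fin N → ℕ) → Fin (b ^ N) → ℕ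
  weighted d x = sumℕ (λ p → toℕ (finToFun {b} {N} x p) * d p)

  split-sum : ∀ x → weighted d⁺ x ≡ weighted (place b) x + weighted d⁻ x
  split-sum x = trans
    (sumℕ-cong λ p → trans (cong (toℕ (finToFun {b} {N} x p) *_) (d⁺≡ p))
      (ℕₚ.*-distribˡ-+ (toℕ (finToFun {b} {N} x p)) (place b p) (d⁻ p)))
    (sumℕ-distrib-+ (λ p → toℕ (finToFun {b} {N} x p) * place b p)
      (λ p → toℕ (finToFun {b} {N} x p) * d⁻ p))

  value : ∀ x → toℕ x ≡ weighted (place b) x
  value x = trans (cong toℕ (sym (Finₚ.funToFin-finToFin {N} {b} x))) (toℕ-funToFin (finToFun {b} {N} x))

  -- Equal codes give equal combinations of the `d⁺` and of the `d⁻`. Cancelling the latter leaves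
  -- the base-`b` expansions of `x` and `x′`.
  code-injective : Injective _≡_ _≡_ code
  code-injective {x} {x′} e with Finₚ.combine-injective (funToFin (M⁺.multFin (finToFun x))) _ _ _ e
  ... | e⁺ , e⁻ = Finₚ.toℕ-injective (trans (value x) (trans
    (ℕₚ.+-cancelʳ-≡ (weighted d⁻ x) (weighted (place b) x) (weighted (place b) x′) (begin
      weighted (place b) x + weighted d⁻ x    ≡⟨ split-sum x ⟨
      weighted d⁺ x                            ≡⟨ M⁺.combination-cong (finToFun x) (finToFun x′) e⁺ ⟩
      weighted d⁺ x′                           ≡⟨ split-sum x′ ⟩
      weighted (place b) x′ + weighted d⁻ x′  ≡⟨ cong (weighted (place b) x′ +_)
                                                    (M⁻.combination-cong (finToFun x) (finToFun x′) e⁻) ⟨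
      weighted (place b) x′ + weighted d⁻ x   ∎))
    (sym (value x′))))
    where open ≡-Reasoning

-- The grid is planar

data Dir : Set where
  east north west south : Dir

left : Dir → Dir
left east  = north
left north = west
left west  = south
left south = east

left⁴ : ∀ a → left (left (left (left a))) ≡ a
left⁴ east  = refl
left⁴ north = refl
left⁴ west  = refl
left⁴ south = refl

left^ : ∀ a b → b ≡ a ⊎ b ≡ left a ⊎ b ≡ left (left a) ⊎ b ≡ left (left (left a))
left^ east  east  = inj₁ refl
left^ east  north = inj₂ (inj₁ refl)
left^ east  west  = inj₂ (inj₂ (inj₁ refl))
left^ east  south = inj₂ (inj₂ (inj₂ refl))
left^ north north = inj₁ refl
left^ north west  = inj₂ (inj₁ refl)
left^ north south = inj₂ (inj₂ (inj₁ refl))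
left^ north east  = inj₂ (inj₂ (inj₂ refl))
left^ west  west  = inj₁ refl
left^ west  south = inj₂ (inj₁ refl)
left^ west  east  = inj₂ (inj₂ (inj₁ refl))
left^ west  north = inj₂ (inj₂ (inj₂ refl))
left^ south south = inj₁ refl
left^ south east  = inj₂ (inj₁ refl)
left^ south north = inj₂ (inj₂ (inj₁ refl))
left^ south west  = inj₂ (inj₂ (inj₂ refl))

module Compass {A V : Set} (origin : A → V) (dir : A → Dir) (at : V → Dir → Maybe A)
               (at-origin : ∀ d → at (origin d) (dir d) ≡ just d)
               (at-sound : ∀ {v a d} → at v a ≡ just d → origin d ≡ v × dir d ≡ a) where

  -- The first dart met when turning left from `a`. The fallback `d` is taken at a vertex without
  -- another dart.
  turning : (Dir → Maybe A) → Dir → A → A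
  turning M a d = fromMaybe d (M (left a) <∣> M (left (left a)) <∣> M (left (left (left a))))

  -- Three left turns are one right turn: this searches clockwise and yields the inverse by which
  -- `rot` is seen to be injective.
  turning⁻ : (Dir → Maybe A) → Dir → A → A
  turning⁻ M a d = fromMaybe d (M (left (left (left a))) <∣> M (left (left a)) <∣> M (left a))

  rot rot⁻ : A → A
  rot  d = turning (at (origin d)) (dir d) d
  rot⁻ d = turning⁻ (at (origin d)) (dir d) d

  rot-≡ : ∀ {v a d} → at v a ≡ just d → rot d ≡ turning (at v) a d
  rot-≡ {d = d} e = cong₂ (λ v a → turning (at v) a d) (proj₁ (at-sound e)) (proj₂ (at-sound e))

  rot⁻-≡ : ∀ {v a d} → at v a ≡ just d → rot⁻ d ≡ turning⁻ (at v) a d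
  rot⁻-≡ {d = d} e = cong₂ (λ v a → turning⁻ (at v) a d) (proj₁ (at-sound e)) (proj₂ (at-sound e))

  module _ {v : V} {a : Dir} {d : A} (e : at v a ≡ just d) where

    rot₁ : ∀ {x} → at v (left a) ≡ just x → rot d ≡ x
    rot₁ e₁ rewrite rot-≡ e | e₁ = refl

    rot₂ : ∀ {x} → at v (left a) ≡ nothing → at v (left (left a)) ≡ just x → rot d ≡ x
    rot₂ e₁ e₂ rewrite rot-≡ e | e₁ | e₂ = refl

    rot₃ : ∀ {x} → at v (left a) ≡ nothing → at v (left (left a)) ≡ nothing →
      at v (left (left (left a))) ≡ just x → rot d ≡ x
    rot₃ e₁ e₂ e₃ rewrite rot-≡ e | e₁ | e₂ | e₃ = refl

    rot₄ : at v (left a) ≡ nothing → at v (left (left a)) ≡ nothing →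
      at v (left (left (left a))) ≡ nothing → rot d ≡ d
    rot₄ e₁ e₂ e₃ rewrite rot-≡ e | e₁ | e₂ | e₃ = refl

    rot⁻-rot : rot⁻ (rot d) ≡ d
    rot⁻-rot with at v (left a) in e₁
    ... | just x rewrite rot₁ e₁ | rot⁻-≡ e₁ | left⁴ a | e = refl
    ... | nothing with at v (left (left a)) in e₂
    ...   | just x rewrite rot₂ e₁ e₂ | rot⁻-≡ e₂ | left⁴ a | e₁ | e = refl
    ...   | nothing with at v (left (left (left a))) in e₃
    ...     | just x rewrite rot₃ e₁ e₂ e₃ | rot⁻-≡ e₃ | left⁴ a | e₂ | e₁ | e = refl
    ...     | nothing rewrite rot₄ e₁ e₂ e₃ | rot⁻-≡ e | e₃ | e₂ | e₁ = refl

    -- Every direction is at most three left turns away, and absent darts only save turns. The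
    -- explicit bound enters the step count for connectedness.
    reach : ∀ {b d′} → at v b ≡ just d′ → ∃ λ t → t ≤ 3 × iter t rot d ≡ d′
    reach {b} e′ with left^ a b
    ... | inj₁ refl = 0 , z≤n , Maybeₚ.just-injective (trans (sym e) e′)
    ... | inj₂ (inj₁ refl) = 1 , s≤s z≤n , rot₁ e′
    reach {b} e′ | inj₂ (inj₂ (inj₁ refl)) with at v (left a) in e₁
    ... | nothing = 1 , s≤s z≤n , rot₂ e₁ e′
    ... | just x  = 2 , s≤s (s≤s z≤n) , trans (cong rot (rot₁ e₁)) (trans (rot-≡ e₁) (lemma e′))
      where
      lemma : ∀ {y} → at v (left (left a)) ≡ just y → turning (at v) (left a) x ≡ y
      lemma e₂ rewrite e₂ = refl
    reach {b} e′ | inj₂ (inj₂ (inj₂ refl)) = third (at v (left a)) (at v (left (left a))) refl refl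
      where
      next : ∀ {c x y} → at v c ≡ just x → at v (left c) ≡ just y → rot x ≡ y
      next p q rewrite rot-≡ p | q = refl
      skip : ∀ {c x y} → at v c ≡ just x → at v (left c) ≡ nothing → at v (left (left c)) ≡ just y → rot x ≡ y
      skip p q r rewrite rot-≡ p | q | r = refl
      third : ∀ m₁ m₂ → at v (left a) ≡ m₁ → at v (left (left a)) ≡ m₂ → ∃ λ t → t ≤ 3 × iter t rot d ≡ _
      third (just x) (just y) e₁ e₂ = 3 , ℕₚ.≤-refl , trans (cong (rot ∘ rot) (rot₁ e₁)) (trans (cong rot (next e₁ e₂)) (next e₂ e′))
      third (just x) nothing  e₁ e₂ = 2 , s≤s (s≤s z≤n) , trans (cong rot (rot₁ e₁)) (skip e₁ e₂ e′)
      third nothing (just y)  e₁ e₂ = 2 , s≤s (s≤s z≤n) , trans (cong rot (rot₂ e₁ e₂)) (next e₂ e′)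
      third nothing nothing   e₁ e₂ = 1 , s≤s z≤n , rot₃ e₁ e₂ e′

    origin-rot : origin (rot d) ≡ v
    origin-rot with at v (left a) in e₁
    ... | just x rewrite rot₁ e₁ = proj₁ (at-sound e₁)
    ... | nothing with at v (left (left a)) in e₂
    ...   | just x rewrite rot₂ e₁ e₂ = proj₁ (at-sound e₂)
    ...   | nothing with at v (left (left (left a))) in e₃
    ...     | just x rewrite rot₃ e₁ e₂ e₃ = proj₁ (at-sound e₃)
    ...     | nothing rewrite rot₄ e₁ e₂ e₃ = proj₁ (at-sound e)

  rot-injective : Injective _≡_ _≡_ rot
  rot-injective {x} {y} e = trans (sym (rot⁻-rot (at-origin x))) (trans (cong rot⁻ e) (rot⁻-rot (at-origin y)))

  rot-origin : ∀ d → origin (rot d) ≡ origin d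
  rot-origin d = origin-rot (at-origin d)

  rot-transitive : ∀ d d′ → origin d ≡ origin d′ → ∃ λ t → t ≤ 3 × iter t rot d ≡ d′
  rot-transitive d d′ e = reach (at-origin d) (trans (cong (λ v → at v (dir d′)) e) (at-origin d′))

-- `lower` and `upper` are the partial inverses of `inject₁` and `suc`: on a line of `suc q` points,
-- they give the edge that begins, respectively ends, at a point, if there is one.
lower : ∀ {q} → Fin (suc q) → Maybe (Fin q)
lower {zero}  zero    = nothing
lower {suc q} zero    = just zero
lower {suc q} (suc r) = Maybe.map suc (lower r)

upper : ∀ {q} → Fin (suc q) → Maybe (Fin q)
upper zero    = nothing
upper (suc r) = just r

lower-inject₁ : ∀ {q} (r : Fin q) → lower (inject₁ r) ≡ just r
lower-inject₁ zero    = refl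
lower-inject₁ (suc r) = cong (Maybe.map suc) (lower-inject₁ r)

lower-sound : ∀ {q} {r : Fin (suc q)} {s} → lower r ≡ just s → inject₁ s ≡ r
lower-sound {suc q} {zero}  refl = refl
lower-sound {suc q} {suc r} e with lower r in eq
lower-sound {suc q} {suc r} refl | just s = cong suc (lower-sound eq)

upper-sound : ∀ {q} {r : Fin (suc q)} {s} → upper r ≡ just s → suc s ≡ r
upper-sound {r = suc r} refl = refl

lower-fromℕ : ∀ q → lower (fromℕ q) ≡ nothing
lower-fromℕ zero    = refl
lower-fromℕ (suc q) = cong (Maybe.map suc) (lower-fromℕ q)

-- The square grid as a combinatorial map

module GridMap (q : ℕ) where

  k : ℕ
  k = suc q

  Vertex : Set
  Vertex = Fin k × Fin k

  data Edge : Set where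
    horizontal : Fin k → Fin q → Edge
    vertical   : Fin q → Fin k → Edge

  edges : ℕ
  edges = k * q + q * k

  -- All horizontal edges come first, row by row, then the vertical ones. The descent to the dart of
  -- key 0 relies on this numbering.
  encode : Edge → Fin edges
  encode (horizontal r c) = combine r c ↑ˡ (q * k)
  encode (vertical r c)   = (k * q) ↑ʳ combine r c

  decode′ : Fin (k * q) ⊎ Fin (q * k) → Edge
  decode′ (inj₁ i) = uncurry horizontal (remQuot q i)
  decode′ (inj₂ i) = uncurry vertical (remQuot k i)

  decode : Fin edges → Edge
  decode i = decode′ (splitAt (k * q) i)

  decode-encode : ∀ e → decode (encode e) ≡ e
  decode-encode (horizontal r c) = trans (cong decode′ (Finₚ.splitAt-↑ˡ (k * q) (combine r c) (q * k)))
    (cong (uncurry horizontal) (Finₚ.remQuot-combine r c))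
  decode-encode (vertical r c)   = trans (cong decode′ (Finₚ.splitAt-↑ʳ (k * q) (q * k) (combine r c)))
    (cong (uncurry vertical) (Finₚ.remQuot-combine r c))

  encode-decode : ∀ i → encode (decode i) ≡ i
  encode-decode i = trans (onto (splitAt (k * q) i)) (Finₚ.join-splitAt (k * q) (q * k) i)
    where
    onto : ∀ s → encode (decode′ s) ≡ Fin.join (k * q) (q * k) s
    onto (inj₁ j) = cong (_↑ˡ (q * k)) (Finₚ.combine-remQuot {k} q j)
    onto (inj₂ j) = cong ((k * q) ↑ʳ_) (Finₚ.combine-remQuot {q} k j)

  endsE : Edge → Vertex × Vertex
  endsE (horizontal r c) = (r , inject₁ c) , (r , suc c)
  endsE (vertical r c)   = (inject₁ r , c) , (suc r , c)

  EdgeDart : Set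
  EdgeDart = Edge × Bool

  originE : EdgeDart → Vertex
  originE (e , false) = proj₁ (endsE e)
  originE (e , true)  = proj₂ (endsE e)

  dirE : EdgeDart → Dir
  dirE (horizontal _ _ , false) = east
  dirE (horizontal _ _ , true)  = west
  dirE (vertical _ _   , false) = south
  dirE (vertical _ _   , true)  = north

  atE : Vertex → Dir → Maybe EdgeDart
  atE (r , c) east  = Maybe.map (λ c′ → horizontal r c′ , false) (lower c)
  atE (r , c) north = Maybe.map (λ r′ → vertical r′ c , true) (upper r)
  atE (r , c) west  = Maybe.map (λ c′ → horizontal r c′ , true) (upper c)
  atE (r , c) south = Maybe.map (λ r′ → vertical r′ c , false) (lower r)

  atE-origin : ∀ d → atE (originE d) (dirE d) ≡ just d
  atE-origin (horizontal r c , false) rewrite lower-inject₁ c = refl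
  atE-origin (horizontal r c , true)  = refl
  atE-origin (vertical r c   , false) rewrite lower-inject₁ r = refl
  atE-origin (vertical r c   , true)  = refl

  atE-sound : ∀ {v a d} → atE v a ≡ just d → originE d ≡ v × dirE d ≡ a
  atE-sound {r , c} {east}  e with lower c in eq
  atE-sound {r , c} {east}  refl | just _ = cong (r ,_) (lower-sound eq) , refl
  atE-sound {r , c} {north} e with upper r in eq
  atE-sound {r , c} {north} refl | just _ = cong (_, c) (upper-sound eq) , refl
  atE-sound {r , c} {west}  e with upper c in eq
  atE-sound {r , c} {west}  refl | just _ = cong (r ,_) (upper-sound eq) , refl
  atE-sound {r , c} {south} e with lower r in eq
  atE-sound {r , c} {south} refl | just _ = cong (_, c) (lower-sound eq) , refl

  open Compass originE dirE atE atE-origin atE-sound public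

  -- The cell on the right of a dart; nothing is the outer face.
  cell : EdgeDart → Maybe (Fin q × Fin q)
  cell (horizontal r c , false) = Maybe.map (λ r′ → r′ , c) (lower r)
  cell (horizontal r c , true)  = Maybe.map (λ r′ → r′ , c) (upper r)
  cell (vertical r c   , false) = Maybe.map (λ c′ → r , c′) (upper c)
  cell (vertical r c   , true)  = Maybe.map (λ c′ → r , c′) (lower c)

  -- The sector swept from `d` to the next dart on its left lies to the right of `rot d` and to the
  -- left of `d`, that is, to the right of the flipped dart. If a dart is missing in between, the
  -- sector belongs to the outer face. Hence `cell` is constant along faces.
  cell-rot : ∀ d → cell (rot d) ≡ cell (proj₁ d , not (proj₂ d))
  cell-rot (horizontal (suc r) c , false) rewrite lower-inject₁ c = refl
  cell-rot (horizontal zero (suc c) , false) = refl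
  cell-rot (horizontal zero zero , false) = refl
  cell-rot (horizontal r c , true) with lower r in eq
  ... | just _ = refl
  ... | nothing with lower (suc c) in eq′
  ...   | just _ rewrite eq = refl
  cell-rot (horizontal (suc r) c , true) | nothing | nothing rewrite eq′ = refl
  cell-rot (horizontal zero c , true) | nothing | nothing = refl
  cell-rot (vertical r c , false) with lower c in eq
  ... | just _ rewrite lower-inject₁ r = refl
  cell-rot (vertical (suc r) c , false) | nothing rewrite eq = refl
  cell-rot (vertical zero (suc c) , false) | nothing = refl
  cell-rot (vertical zero zero , false) | nothing = refl
  cell-rot (vertical r (suc c) , true) = refl
  cell-rot (vertical r zero , true) with lower (suc r) in eq
  ... | just _ = refl
  ... | nothing with lower {q} zero in eq′
  ...   | just _ rewrite eq = refl
  ...   | nothing rewrite eq′ = refl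

  module Weighted (ℓ : Edge → ℕ) where

    grid : Graph Vertex
    grid = record { m = edges ; ends = endsE ∘ decode ; len = ℕ→ℚ ∘ ℓ ∘ decode }

    enc : EdgeDart → Dart grid
    enc (e , b) = encode e , b

    dec : Dart grid → EdgeDart
    dec (i , b) = decode i , b

    dec-enc : ∀ d → dec (enc d) ≡ d
    dec-enc (e , b) = cong (_, b) (decode-encode e)

    enc-dec : ∀ d → enc (dec d) ≡ d
    enc-dec (i , b) = cong (_, b) (encode-decode i)

    tail-dec : ∀ d → tail grid d ≡ originE (dec d)
    tail-dec (_ , false) = refl
    tail-dec (_ , true)  = refl

    tail-enc : ∀ d → tail grid (enc d) ≡ originE d
    tail-enc d = trans (tail-dec (enc d)) (cong originE (dec-enc d))

    σ : Dart grid → Dart grid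
    σ = enc ∘ rot ∘ dec

    dec-σ : ∀ d → dec (σ d) ≡ rot (dec d)
    dec-σ d = dec-enc (rot (dec d))

    iter-σ : ∀ t d → iter t σ d ≡ enc (iter t rot (dec d))
    iter-σ zero    d = sym (enc-dec d)
    iter-σ (suc t) d = cong (enc ∘ rot) (trans (cong dec (iter-σ t d)) (dec-enc (iter t rot (dec d))))

    σ-injective : Injective _≡_ _≡_ σ
    σ-injective {x} {y} e = trans (sym (enc-dec x)) (trans (cong enc (rot-injective {dec x} {dec y}
      (trans (sym (dec-σ x)) (trans (cong dec e) (dec-σ y))))) (enc-dec y))

    σ-transitive : ∀ d d′ → tail grid d ≡ tail grid d′ → ∃ λ t → t ≤ 3 × iter t σ d ≡ d′
    σ-transitive d d′ e with rot-transitive (dec d) (dec d′) (trans (sym (tail-dec d)) (trans e (tail-dec d′)))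
    ... | t , t≤3 , e′ = t , t≤3 , trans (iter-σ t d) (trans (cong enc e′) (enc-dec d′))

    tail-σ : ∀ d → tail grid (σ d) ≡ tail grid d
    tail-σ d = trans (tail-dec (σ d)) (trans (cong originE (dec-σ d))
      (trans (rot-origin (dec d)) (sym (tail-dec d))))

    grid-rotation : RotationSystem grid σ
    grid-rotation = σ-injective , tail-σ , λ d d′ e → let t , _ , e′ = σ-transitive d d′ e in t , e′

    grid-IsGrid : IsGrid k grid
    grid-IsGrid = adjacent ∘ decode , λ x y a → let e , p = edge-between x y a in
      encode e , subst (λ e → endsE e ≡ (x , y) ⊎ endsE e ≡ (y , x)) (sym (decode-encode e)) p
      where
      adjacent : ∀ e → GridAdj (proj₁ (endsE e)) (proj₂ (endsE e))
      adjacent (horizontal r c) = inj₁ (refl , inj₁ (cong suc (Finₚ.toℕ-inject₁ c)))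
      adjacent (vertical r c)   = inj₂ (refl , inj₁ (cong suc (Finₚ.toℕ-inject₁ r)))
      succ : ∀ (i j : Fin k) → suc (toℕ i) ≡ toℕ j → ∃ λ c → i ≡ inject₁ c × j ≡ suc c
      succ i (suc c) e = c , Finₚ.toℕ-injective (trans (ℕₚ.suc-injective e) (sym (Finₚ.toℕ-inject₁ c))) , refl
      edge-between : ∀ x y → GridAdj x y → ∃ λ e → endsE e ≡ (x , y) ⊎ endsE e ≡ (y , x)
      edge-between (r , i) (r , j) (inj₁ (refl , inj₁ e)) with succ i j e
      ... | c , refl , refl = horizontal r c , inj₁ refl
      edge-between (r , i) (r , j) (inj₁ (refl , inj₂ e)) with succ j i e
      ... | c , refl , refl = horizontal r c , inj₂ refl
      edge-between (i , c) (j , c) (inj₂ (refl , inj₁ e)) with succ i j e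
      ... | r , refl , refl = vertical r c , inj₁ refl
      edge-between (i , c) (j , c) (inj₂ (refl , inj₂ e)) with succ j i e
      ... | r , refl , refl = vertical r c , inj₂ refl

  -- Euler's formula for the grid

  module Planarity (q⁺ : 1 ≤ q) (ℓ : Edge → ℕ) where
    open Weighted ℓ
    open Darts grid

    firstColumn : Fin q
    firstColumn = Fin.fromℕ< q⁺

    -- The colour is the tail. As `1 ≤ q`, every vertex has a dart to sample: the one to the west,
    -- or in the first column the one to the east.
    vertex-orbits-≥ : k * k ≤ orbitCount grid σ
    vertex-orbits-≥ = orbitCount-≥ (uncurry combine ∘ tail grid) (enc ∘ uncurry outgoing ∘ remQuot k)
      (λ i → trans (cong (uncurry combine) (outgoing-tail (remQuot k i))) (Finₚ.combine-remQuot {k} k i))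
      σ (λ d → cong (uncurry combine) (tail-σ d))
      where
      outgoing : Fin k → Fin k → EdgeDart
      outgoing r zero    = horizontal r firstColumn , false
      outgoing r (suc c) = horizontal r c , true
      first : inject₁ firstColumn ≡ zero
      first = Finₚ.toℕ-injective (trans (Finₚ.toℕ-inject₁ firstColumn) (Finₚ.toℕ-fromℕ< q⁺))
      origin-outgoing : ∀ r c → originE (outgoing r c) ≡ (r , c)
      origin-outgoing r zero    = cong (r ,_) first
      origin-outgoing r (suc c) = refl
      outgoing-tail : ∀ v → tail grid (enc (uncurry outgoing v)) ≡ v
      outgoing-tail (r , c) = trans (tail-enc (outgoing r c)) (origin-outgoing r c)

    -- The colour is the cell on the right. A cell is sampled by the eastward dart on its upper
    -- side, the outer face by an eastward dart in the last row.
    face-orbits-≥ : suc (q * q) ≤ orbitCount grid (σ ∘ flip grid)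
    face-orbits-≥ = orbitCount-≥ (number ∘ cell ∘ dec) (enc ∘ beside)
      (λ i → trans (cong (number ∘ cell) (dec-enc (beside i))) (number-beside i))
      (σ ∘ flip grid) λ { (i , b) → cong number (trans (cong cell (dec-σ (i , not b)))
        (trans (cell-rot (decode i , not b)) (cong (λ b → cell (decode i , b)) (Boolₚ.not-involutive b)))) }
      where
      number : Maybe (Fin q × Fin q) → Fin (suc (q * q))
      number nothing        = zero
      number (just (r , c)) = suc (combine r c)
      beside : Fin (suc (q * q)) → EdgeDart
      beside zero    = horizontal (fromℕ q) firstColumn , false
      beside (suc i) = horizontal (inject₁ (proj₁ (remQuot {q} q i))) (proj₂ (remQuot {q} q i)) , false
      number-beside : ∀ i → number (cell (beside i)) ≡ i
      number-beside zero    rewrite lower-fromℕ q = refl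
      number-beside (suc i) rewrite lower-inject₁ (proj₁ (remQuot {q} q i)) = cong suc (Finₚ.combine-remQuot {q} q i)

    rotations : ∀ {j d d′} t → Steps σ j (iter t σ d) d′ → Steps σ (t + j) d d′
    rotations         zero    s = s
    rotations {j} {d} {d′} (suc t) s = subst (λ n → Steps σ n d d′) (ℕₚ.+-suc t j) (rotations t (rotate s))

    toVertexMate : ∀ {j d₁} d d′ → originE d ≡ originE d′ → Steps σ j (enc d′) d₁ →
      ∃ λ i → i ≤ 3 + j × Steps σ i (enc d) d₁
    toVertexMate {j} d d′ e s with σ-transitive (enc d) (enc d′)
      (trans (tail-enc d) (trans e (sym (tail-enc d′))))
    ... | t , t≤3 , e′ = t + j , ℕₚ.+-monoˡ-≤ j t≤3 , rotations t (subst (λ x → Steps σ j x _) (sym e′) s)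

    κ-horizontal : ∀ r c → toℕ (encode (horizontal r c)) ≡ q * toℕ r + toℕ c
    κ-horizontal r c = trans (Finₚ.toℕ-↑ˡ (combine r c) (q * k)) (Finₚ.toℕ-combine r c)

    horizontal<vertical : ∀ r c r′ c′ → toℕ (encode (horizontal r c)) < toℕ (encode (vertical r′ c′))
    horizontal<vertical r c r′ c′ = subst₂ _<_ (sym (Finₚ.toℕ-↑ˡ (combine r c) (q * k)))
      (sym (Finₚ.toℕ-↑ʳ (k * q) (combine r′ c′))) (ℕₚ.<-≤-trans (Finₚ.toℕ<n (combine r c)) (ℕₚ.m≤m+n _ _))

    κ-< : ∀ e e′ b → toℕ (encode e) < toℕ (encode e′) → κ (enc (e , b)) < κ (enc (e′ , false))
    κ-< e e′ b lt = begin-strict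
      κ (enc (e , b))               ≤⟨ ℕₚ.+-monoʳ-≤ (2 * toℕ (encode e)) (bit b) ⟩
      2 * toℕ (encode e) + 1       <⟨ ℕₚ.+-monoʳ-< (2 * toℕ (encode e)) (ℕₚ.n<1+n 1) ⟩
      2 * toℕ (encode e) + 2       ≡⟨ trans (ℕₚ.+-comm _ 2) (sym (ℕₚ.*-suc 2 (toℕ (encode e)))) ⟩
      2 * suc (toℕ (encode e))      ≤⟨ ℕₚ.*-monoʳ-≤ 2 lt ⟩
      2 * toℕ (encode e′)           ≡⟨ ℕₚ.+-identityʳ _ ⟨
      κ (enc (e′ , false))          ∎
      where
      open ℕₚ.≤-Reasoning
      bit : ∀ b → (if b then 1 else 0) ≤ 1
      bit false = z≤n
      bit true  = ℕₚ.≤-refl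

    below : ∀ r c r′ c′ b → κ (enc (horizontal r c , b)) < κ (enc (vertical r′ c′ , false))
    below r c r′ c′ b = κ-< (horizontal r c) (vertical r′ c′) b (horizontal<vertical r c r′ c′)

    -- Seven is the longest descent: at most three rotations to the northward dart, one flip, at
    -- most three rotations to the eastward dart. The smallest grid considered, `q = 1`, has eight
    -- darts.
    7≤darts : 7 ≤ 2 * edges
    7≤darts = ℕₚ.≤-trans (ℕₚ.n≤1+n 7) (ℕₚ.*-monoʳ-≤ 2 (ℕₚ.+-mono-≤ (ℕₚ.*-mono-≤ (s≤s q⁺) q⁺) (ℕₚ.*-mono-≤ q⁺ (s≤s q⁺))))

    Descent : EdgeDart → Set
    Descent d = ∃ λ d′ → κ d′ < κ (enc d) × ∃ λ j → j ≤ 2 * edges × Steps σ j (enc d) d′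

    to-mate : ∀ d d′ → originE d ≡ originE d′ → κ (enc d′) < κ (enc d) → Descent d
    to-mate d d′ e lt with toVertexMate d d′ e start
    ... | i , i≤3 , s = enc d′ , lt , i , ℕₚ.≤-trans i≤3 (ℕₚ.≤-trans (ℕₚ.m≤m+n 3 4) 7≤darts) , s

    first-index : ∀ r c → toℕ r ≡ 0 → toℕ c ≡ 0 → κ (enc (horizontal r c , false)) ≡ 0
    first-index r c r≡0 c≡0 = cong (λ x → 2 * x + 0) (trans (κ-horizontal r c)
      (trans (cong₂ (λ x y → q * x + y) r≡0 c≡0) (trans (ℕₚ.+-identityʳ (q * 0)) (ℕₚ.*-zeroʳ q))))

    -- Every dart but the first can walk, within seven steps, to a dart of smaller key: along its row to
    -- the west, and in the first column up to the previous row.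
    descend : ∀ d → 0 < κ (enc d) → Descent d
    descend (e , true) _ = enc (e , false) , ℕₚ.+-monoʳ-< (2 * toℕ (encode e)) (ℕₚ.n<1+n 0) ,
      1 , ℕₚ.≤-trans (s≤s z≤n) 7≤darts , turn start
    descend d@(horizontal r (suc c) , false) _ = to-mate d (horizontal r (inject₁ c) , true) refl
      (κ-< (horizontal r (inject₁ c)) (horizontal r (suc c)) true (subst₂ _<_ (sym (κ-horizontal r (inject₁ c))) (sym (κ-horizontal r (suc c)))
        (ℕₚ.+-monoʳ-< (q * toℕ r) (s≤s (ℕₚ.≤-reflexive (Finₚ.toℕ-inject₁ c))))))
    descend (horizontal zero zero , false) pos = contradiction (first-index zero zero refl refl) (ℕₚ.>⇒≢ pos)
    descend (horizontal (suc r) zero , false) _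
      with toVertexMate (vertical r zero , false) (horizontal (inject₁ r) zero , false) refl start
    ... | i , i≤3 , s with toVertexMate (horizontal (suc r) zero , false) (vertical r zero , true) refl (turn s)
    ...   | j , j≤ , s′ = enc (horizontal (inject₁ r) zero , false) ,
      κ-< (horizontal (inject₁ r) zero) (horizontal (suc r) zero) false (subst₂ _<_ (sym (κ-horizontal (inject₁ r) zero)) (sym (κ-horizontal (suc r) zero))
        (ℕₚ.+-monoˡ-< 0 (subst (λ x → q * x < q * suc (toℕ r)) (sym (Finₚ.toℕ-inject₁ r))
          (ℕₚ.*-monoʳ-< q (ℕₚ.n<1+n (toℕ r)))))) ,
      j , ℕₚ.≤-trans j≤ (ℕₚ.≤-trans (ℕₚ.+-monoʳ-≤ 4 i≤3) 7≤darts) , s′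
    descend d@(vertical r (suc c) , false) _ =
      to-mate d (horizontal (inject₁ r) c , true) refl (below (inject₁ r) c r (suc c) true)
    descend d@(vertical zero zero , false) _ =
      to-mate d (horizontal zero zero , false) refl (below zero zero zero zero false)
    descend d@(vertical (suc r) zero , false) _ =
      to-mate d (horizontal (inject₁ (suc r)) zero , false) refl (below (inject₁ (suc r)) zero (suc r) zero false)

    components-≤1 : compCount grid σ ≤ 1
    components-≤1 = compCount-≤1 σ λ d pos → subst
      (λ x → ∃ λ d′ → κ d′ < κ x × ∃ λ j → j ≤ 2 * edges × Steps σ j x d′) (enc-dec d)
      (descend (dec d) (subst (λ x → 0 < κ x) (sym (enc-dec d)) pos))

    -- Lower bounds on orbits and the single component give one direction. The other is `euler-≤`,
    -- valid for every map, so no orbit count is computed exactly.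
    grid-genus : orbitCount grid σ + orbitCount grid (σ ∘ flip grid) ≡ edges + 2 * compCount grid σ
    grid-genus = ℕₚ.≤-antisym upper-bound (begin
      edges + 2 * compCount grid σ                         ≤⟨ ℕₚ.+-monoʳ-≤ edges (ℕₚ.*-monoʳ-≤ 2 components-≤1) ⟩
      edges + 2                                            ≡⟨ solve 1 (λ q → ((con 1 :+ q) :* q :+ q :* (con 1 :+ q)) :+ con 2
                                                                := (con 1 :+ q) :* (con 1 :+ q) :+ (con 1 :+ q :* q)) refl q ⟩
      k * k + suc (q * q)                                  ≤⟨ ℕₚ.+-mono-≤ vertex-orbits-≥ face-orbits-≥ ⟩
      orbitCount grid σ + orbitCount grid (σ ∘ flip grid)  ∎)
      where
      open ℕₚ.≤-Reasoning
      open +-*-Solver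
      φ-injective : Injective _≡_ _≡_ (σ ∘ flip grid)
      φ-injective e = trans (sym (flip-involutive _)) (trans (cong (flip grid) (σ-injective e)) (flip-involutive _))
      upper-bound : orbitCount grid σ + orbitCount grid (σ ∘ flip grid) ≤ edges + 2 * compCount grid σ
      upper-bound = ℕₚ.≤-trans
        (ℕₚ.+-mono-≤ (orbitCount-≤ σ-injective (proj₂ (∃-orbits σ))) (orbitCount-≤ φ-injective (proj₂ (∃-orbits (σ ∘ flip grid)))))
        (ℕₚ.≤-trans (euler-≤ grid σ-injective (proj₂ (∃-orbits σ)) (proj₂ (∃-orbits (σ ∘ flip grid))) (proj₂ (∃-components σ)))
          (ℕₚ.+-monoʳ-≤ edges (ℕₚ.*-monoʳ-≤ 2 (compCount-≥ σ (proj₂ (∃-components σ))))))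

-- The one-point grid has no darts to sample, but there both sides of the formula compute to 0.
grid-planar : ∀ q ℓ → Planar (GridMap.Weighted.grid q ℓ)
grid-planar zero    ℓ = GridMap.Weighted.σ 0 ℓ , GridMap.Weighted.grid-rotation 0 ℓ , refl
grid-planar (suc q) ℓ = GridMap.Weighted.σ (suc q) ℓ , GridMap.Weighted.grid-rotation (suc q) ℓ ,
  GridMap.Planarity.grid-genus (suc q) (s≤s z≤n) ℓ

-- Distances in the grid

module _ {V : Set} (G : Graph V) where

  append : ∀ {u v w} (p : Walk G u v) (q : Walk G v w) →
    ∃ λ (r : Walk G u w) → walkLen r ≡ walkLen p ℚ.+ walkLen q
  append nil        q = q , sym (ℚₚ.+-identityˡ _)
  append (cons d p) q = let r , e = append p q in
    cons d r , trans (cong (len G (proj₁ d) ℚ.+_) e) (sym (ℚₚ.+-assoc (len G (proj₁ d)) (walkLen p) (walkLen q)))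

  Reach : V → V → ℕ → Set
  Reach u v x = ∃ λ (p : Walk G u v) → walkLen p ≡ ℕ→ℚ x

  reach-trans : ∀ {u v w} x y → Reach u v x → Reach v w y → Reach u w (x + y)
  reach-trans x y (p , p≡x) (q , q≡y) = let r , e = append p q in
    r , trans e (trans (cong₂ ℚ._+_ p≡x q≡y) (sym (ℕ→ℚ-+ x y)))

  -- A potential that rises along no dart by more than its length is the dual certificate for a
  -- shortest path.
  potential-≤ : (f : V → ℕ) → (∀ d → ℕ→ℚ (f (head G d)) ℚ.≤ ℕ→ℚ (f (tail G d)) ℚ.+ len G (proj₁ d)) →
    ∀ {u v} (p : Walk G u v) → ℕ→ℚ (f v) ℚ.≤ ℕ→ℚ (f u) ℚ.+ walkLen p
  potential-≤ f lipschitz nil        = ℚₚ.≤-reflexive (sym (ℚₚ.+-identityʳ _))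
  potential-≤ f lipschitz {v = v} (cons d p) = begin
    ℕ→ℚ (f v)                                                    ≤⟨ potential-≤ f lipschitz p ⟩
    ℕ→ℚ (f (head G d)) ℚ.+ walkLen p                             ≤⟨ ℚₚ.+-monoˡ-≤ (walkLen p) (lipschitz d) ⟩
    (ℕ→ℚ (f (tail G d)) ℚ.+ len G (proj₁ d)) ℚ.+ walkLen p       ≡⟨ ℚₚ.+-assoc (ℕ→ℚ (f (tail G d))) (len G (proj₁ d)) (walkLen p) ⟩
    ℕ→ℚ (f (tail G d)) ℚ.+ (len G (proj₁ d) ℚ.+ walkLen p)       ∎
    where open ℚₚ.≤-Reasoning

module GridMetric (q : ℕ) (h : ℕ → ℕ → ℕ) (v : ℕ) where
  open GridMap q

  prefix : ℕ → ℕ → ℕ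
  prefix r zero    = 0
  prefix r (suc c) = prefix r c + h r c

  ℓ : Edge → ℕ
  ℓ (horizontal r c) = h (toℕ r) (toℕ c)
  ℓ (vertical _ _)   = v

  open Weighted ℓ public

  edge-reach : ∀ e → Reach grid (proj₁ (endsE e)) (proj₂ (endsE e)) (ℓ e)
  edge-reach e with walk-of grid (encode e , false) (cong (proj₁ ∘ endsE) (decode-encode e))
                      (cong (proj₂ ∘ endsE) (decode-encode e)) nil
  ... | p , e′ = p , trans e′ (trans (ℚₚ.+-identityʳ _) (cong (ℕ→ℚ ∘ ℓ) (decode-encode e)))

  edge-reach⁻ : ∀ e → Reach grid (proj₂ (endsE e)) (proj₁ (endsE e)) (ℓ e)
  edge-reach⁻ e with walk-of grid (encode e , true) (cong (proj₂ ∘ endsE) (decode-encode e))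
                      (cong (proj₁ ∘ endsE) (decode-encode e)) nil
  ... | p , e′ = p , trans e′ (trans (ℚₚ.+-identityʳ _) (cong (ℕ→ℚ ∘ ℓ) (decode-encode e)))

  reach-right : ∀ r n (c : Fin k) → toℕ c ≡ n → Reach grid (r , zero) (r , c) (prefix (toℕ r) n)
  reach-right r zero    zero    _ = nil , refl
  reach-right r (suc n) (suc c) e = reach-trans grid (prefix (toℕ r) n) (h (toℕ r) n)
    (reach-right r n (inject₁ c) (trans (Finₚ.toℕ-inject₁ c) (ℕₚ.suc-injective e)))
    (subst (λ x → Reach grid (r , inject₁ c) (r , suc c) (h (toℕ r) x)) (ℕₚ.suc-injective e) (edge-reach (horizontal r c)))

  reach-up : ∀ n (r c : Fin k) → toℕ r ≡ n → Reach grid (r , c) (zero , c) (n * v)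
  reach-up zero    zero    c _ = nil , refl
  reach-up (suc n) (suc r) c e = reach-trans grid v (n * v) (edge-reach⁻ (vertical r c))
    (reach-up n (inject₁ r) c (trans (Finₚ.toℕ-inject₁ r) (ℕₚ.suc-injective e)))

  module _ (antitone : ∀ {r r′} c → r ≤ r′ → h r′ c ≤ h r c) (prefix≤v : ∀ r c → c ≤ q → prefix r c ≤ v) where

    prefix-antitone : ∀ {r r′} c → r ≤ r′ → prefix r′ c ≤ prefix r c
    prefix-antitone zero    r≤r′ = z≤n
    prefix-antitone (suc c) r≤r′ = ℕₚ.+-mono-≤ (prefix-antitone c r≤r′) (antitone c r≤r′)

    -- The distance from (i , 0) in the rows up to i; below row i the vertical moves are ignored.
    pot : ℕ → ℕ → ℕ → ℕ
    pot i r c = prefix (r ⊔ i) c + (i ∸ r) * v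

    pot-right : ∀ i r c → pot i r (suc c) ≤ pot i r c + h r c
    pot-right i r c = begin
      (prefix (r ⊔ i) c + h (r ⊔ i) c) + (i ∸ r) * v  ≤⟨ ℕₚ.+-monoˡ-≤ _ (ℕₚ.+-monoʳ-≤ (prefix (r ⊔ i) c) (antitone c (ℕₚ.m≤m⊔n r i))) ⟩
      (prefix (r ⊔ i) c + h r c) + (i ∸ r) * v        ≡⟨ ℕₚ.+-assoc (prefix (r ⊔ i) c) (h r c) _ ⟩
      prefix (r ⊔ i) c + (h r c + (i ∸ r) * v)        ≡⟨ cong (prefix (r ⊔ i) c +_) (ℕₚ.+-comm (h r c) _) ⟩
      prefix (r ⊔ i) c + ((i ∸ r) * v + h r c)        ≡⟨ ℕₚ.+-assoc (prefix (r ⊔ i) c) _ (h r c) ⟨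
      pot i r c + h r c                                ∎
      where open ℕₚ.≤-Reasoning

    pot-left : ∀ i r c → pot i r c ≤ pot i r (suc c) + h r c
    pot-left i r c = ℕₚ.≤-trans (ℕₚ.+-monoˡ-≤ ((i ∸ r) * v) (ℕₚ.m≤m+n (prefix (r ⊔ i) c) (h (r ⊔ i) c))) (ℕₚ.m≤m+n _ (h r c))

    -- From row `i` downwards only the prefix changes: it does not grow, and it loses at most its
    -- own value, which is bounded by `v`. Above row `i` the prefix is constant and the climbing
    -- term changes by exactly `v`.
    pot-vertical : ∀ i r c → c ≤ q → pot i (suc r) c ≤ pot i r c + v × pot i r c ≤ pot i (suc r) c + v
    pot-vertical i r c c≤q with i ℕ.≤? r
    ... | yes i≤r rewrite ℕₚ.m≥n⇒m⊔n≡m i≤r | ℕₚ.m≥n⇒m⊔n≡m (ℕₚ.m≤n⇒m≤1+n i≤r)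
                        | ℕₚ.m≤n⇒m∸n≡0 i≤r | ℕₚ.m≤n⇒m∸n≡0 (ℕₚ.m≤n⇒m≤1+n i≤r)
                        | ℕₚ.+-identityʳ (prefix r c) | ℕₚ.+-identityʳ (prefix (suc r) c) =
      ℕₚ.≤-trans (prefix-antitone c (ℕₚ.n≤1+n r)) (ℕₚ.m≤m+n _ v) , ℕₚ.≤-trans (prefix≤v r c c≤q) (ℕₚ.m≤n+m v _)
    ... | no i≰r with ℕₚ.≰⇒> i≰r
    ...   | r<i rewrite ℕₚ.m≤n⇒m⊔n≡n r<i | ℕₚ.m≤n⇒m⊔n≡n (ℕₚ.<⇒≤ r<i) | sym (ℕₚ.suc-pred (i ∸ r) {{ℕ.>-nonZero (ℕₚ.m<n⇒0<n∸m r<i)}})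
                      | ℕₚ.pred[m∸n]≡m∸[1+n] i r =
      ℕₚ.≤-trans (ℕₚ.+-monoʳ-≤ (prefix i c) (ℕₚ.m≤n+m _ v)) (ℕₚ.m≤m+n _ v) ,
      ℕₚ.≤-reflexive (trans (cong (prefix i c +_) (ℕₚ.+-comm v _)) (sym (ℕₚ.+-assoc (prefix i c) _ v)))

    potential : ℕ → Vertex → ℕ
    potential i (r , c) = pot i (toℕ r) (toℕ c)

    potential-lipschitz : ∀ i e → potential i (proj₂ (endsE e)) ≤ potential i (proj₁ (endsE e)) + ℓ e
                                × potential i (proj₁ (endsE e)) ≤ potential i (proj₂ (endsE e)) + ℓ e
    potential-lipschitz i (horizontal r c) rewrite Finₚ.toℕ-inject₁ c = pot-right i (toℕ r) (toℕ c) , pot-left i (toℕ r) (toℕ c)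
    potential-lipschitz i (vertical r c)   rewrite Finₚ.toℕ-inject₁ r = pot-vertical i (toℕ r) (toℕ c) (Finₚ.toℕ≤pred[n] c)

    lipschitz : ∀ i d → ℕ→ℚ (potential i (head grid d)) ℚ.≤ ℕ→ℚ (potential i (tail grid d)) ℚ.+ len grid (proj₁ d)
    lipschitz i (j , b) = raise b
      where
      from to : Vertex
      from = proj₁ (endsE (decode j))
      to   = proj₂ (endsE (decode j))
      bound : ∀ x y → x ≤ y + ℓ (decode j) → ℕ→ℚ x ℚ.≤ ℕ→ℚ y ℚ.+ len grid j
      bound x y le = ℚₚ.≤-trans (ℕ→ℚ-mono-≤ {x} {y + ℓ (decode j)} le) (ℚₚ.≤-reflexive (ℕ→ℚ-+ y (ℓ (decode j))))
      raise : ∀ b → ℕ→ℚ (potential i (head grid (j , b))) ℚ.≤ ℕ→ℚ (potential i (tail grid (j , b))) ℚ.+ len grid j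
      raise false = bound (potential i to) (potential i from) (proj₁ (potential-lipschitz i (decode j)))
      raise true  = bound (potential i from) (potential i to) (proj₂ (potential-lipschitz i (decode j)))

    -- Among rows `0` to `r`, row `r` is cheapest for all horizontal moves, and the climb of `r * v`
    -- is unavoidable. A lower row saves at most one prefix, hence at most `v`, no more than the
    -- detour costs.
    grid-dist : ∀ (r c : Fin k) → IsDist grid (r , zero) (zero , c) (ℕ→ℚ (prefix (toℕ r) (toℕ c) + toℕ r * v))
    grid-dist r c = reach-trans grid (prefix (toℕ r) (toℕ c)) (toℕ r * v)
      (reach-right r (toℕ c) c refl) (reach-up (toℕ r) r c refl) , λ p →
      ℚₚ.≤-trans (potential-≤ grid (potential (toℕ r)) (lipschitz (toℕ r)) p)
        -- The potential vanishes at the start; at the end the row is `zero`, and the potential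
        -- computes to the claimed distance.
        (ℚₚ.≤-reflexive (trans (cong (λ x → ℕ→ℚ (x * v) ℚ.+ walkLen p) (ℕₚ.n∸n≡0 (toℕ r))) (ℚₚ.+-identityˡ _)))

  grid-NonNeg : NonNeg grid
  grid-NonNeg i = ℕ→ℚ-mono-≤ {0} {ℓ (decode i)} z≤n

-- The lower bound

module Terminals (q a : ℕ) where

  private
    k : ℕ
    k = suc q

  -- Columns `0` to `a` of the top row come first; `a + 1` columns are needed to see `a` edges of a
  -- row as differences. The left column continues from row 1, so the corner is not repeated.
  terminal : Fin k → Fin k × Fin k
  terminal t with toℕ t ℕ.≤? a
  ... | yes _ = zero , t
  ... | no  _ = fromℕ< (ℕₚ.≤-<-trans (ℕₚ.m∸n≤m (toℕ t) a) (Finₚ.toℕ<n t)) , zero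

  terminal-injective : Injective _≡_ _≡_ terminal
  terminal-injective {t} {t′} e with toℕ t ℕ.≤? a | toℕ t′ ℕ.≤? a
  ... | yes _   | yes _    = cong proj₂ e
  ... | no  t≰a | no  t′≰a = Finₚ.toℕ-injective (ℕₚ.∸-cancelʳ-≡ (ℕₚ.<⇒≤ (ℕₚ.≰⇒> t≰a)) (ℕₚ.<⇒≤ (ℕₚ.≰⇒> t′≰a))
    (trans (sym (Finₚ.toℕ-fromℕ< _)) (trans (cong (toℕ ∘ proj₁) e) (Finₚ.toℕ-fromℕ< _))))
  ... | yes _   | no t′≰a  = contradiction (trans (cong (toℕ ∘ proj₁) e) (Finₚ.toℕ-fromℕ< _))
    (ℕₚ.<⇒≢ (ℕₚ.m<n⇒0<n∸m (ℕₚ.≰⇒> t′≰a)))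
  ... | no t≰a  | yes _    = contradiction (trans (cong (toℕ ∘ proj₁) (sym e)) (Finₚ.toℕ-fromℕ< _))
    (ℕₚ.<⇒≢ (ℕₚ.m<n⇒0<n∸m (ℕₚ.≰⇒> t≰a)))

  module _ (2a≤q : a + a ≤ q) where

    column : ∀ c → c ≤ a → ∃ λ t → ∃ λ c′ → terminal t ≡ (zero , c′) × toℕ c′ ≡ c
    column c c≤a = t , t , is-column , Finₚ.toℕ-fromℕ< c<k
      where
      c<k : c < k
      c<k = s≤s (ℕₚ.≤-trans c≤a (ℕₚ.≤-trans (ℕₚ.m≤m+n a a) 2a≤q))
      t : Fin k
      t = fromℕ< c<k
      is-column : terminal t ≡ (zero , t)
      is-column with toℕ t ℕ.≤? a
      ... | yes _ = refl
      ... | no n  = contradiction (subst (_≤ a) (sym (Finₚ.toℕ-fromℕ< c<k)) c≤a) n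

    row : ∀ r → 1 ≤ r → r ≤ a → ∃ λ t → ∃ λ r′ → terminal t ≡ (r′ , zero) × toℕ r′ ≡ r
    row r 1≤r r≤a = t , is-row
      where
      a+r<k : a + r < k
      a+r<k = s≤s (ℕₚ.≤-trans (ℕₚ.+-monoʳ-≤ a r≤a) 2a≤q)
      t : Fin k
      t = fromℕ< a+r<k
      is-row : ∃ λ r′ → terminal t ≡ (r′ , zero) × toℕ r′ ≡ r
      is-row with toℕ t ℕ.≤? a
      ... | yes t≤a = contradiction (subst (_≤ a) (Finₚ.toℕ-fromℕ< a+r<k) t≤a)
        (ℕₚ.<⇒≱ (ℕₚ.≤-trans (ℕₚ.≤-reflexive (ℕₚ.+-comm 1 a)) (ℕₚ.+-monoʳ-≤ a 1≤r)))
      ... | no _    = _ , refl , trans (Finₚ.toℕ-fromℕ< _)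
        (trans (cong (_∸ a) (Finₚ.toℕ-fromℕ< a+r<k)) (ℕₚ.m+n∸m≡n a r))

-- For `n < N` a multiplicity takes at most `N ^ 3` values, so two vectors of `M` entries give
-- `N ^ N ≤ N ^ (6 * M)`, and `2 ≤ N` allows the exponents to be compared. If `N ≤ n`, the claim is
-- immediate.
digits⇒≤ : ∀ {N n M} → 2 ≤ N → M ≤ 3 * n →
  N ^ N ≤ suc (N * (N * n)) ^ M * suc (N * (N * n)) ^ M → N ≤ 18 * n
digits⇒≤ {N} {n} {M} 2≤N M≤3n bound = by-cases (N ℕ.≤? n)
  where
  open ℕₚ.≤-Reasoning
  base : n < N → suc (N * (N * n)) ≤ N ^ 3
  base n<N = begin
    suc (N * (N * n))        ≤⟨ ℕₚ.+-monoˡ-≤ (N * (N * n)) (ℕₚ.*-mono-≤ (ℕₚ.<⇒≤ 2≤N) (ℕₚ.<⇒≤ 2≤N)) ⟩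
    N * N + N * (N * n)     ≡⟨ solve 2 (λ x y → x :* x :+ x :* (x :* y) := x :* (x :* ((con 1 :+ y) :* con 1))) refl N n ⟩
    N * (N * (suc n * 1))    ≤⟨ ℕₚ.*-monoʳ-≤ N (ℕₚ.*-monoʳ-≤ N (ℕₚ.*-monoˡ-≤ 1 n<N)) ⟩
    N ^ 3                    ∎
    where open +-*-Solver
  powers : n < N → N ^ N ≤ N ^ (6 * M)
  powers n<N = begin
    N ^ N                                              ≤⟨ bound ⟩
    suc (N * (N * n)) ^ M * suc (N * (N * n)) ^ M      ≤⟨ ℕₚ.*-mono-≤ (ℕₚ.^-monoˡ-≤ M (base n<N)) (ℕₚ.^-monoˡ-≤ M (base n<N)) ⟩
    (N ^ 3) ^ M * (N ^ 3) ^ M                          ≡⟨ cong₂ _*_ (ℕₚ.^-*-assoc N 3 M) (ℕₚ.^-*-assoc N 3 M) ⟩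
    N ^ (3 * M) * N ^ (3 * M)                          ≡⟨ ℕₚ.^-distribˡ-+-* N (3 * M) (3 * M) ⟨
    N ^ (3 * M + 3 * M)                               ≡⟨ cong (N ^_) (ℕₚ.*-distribʳ-+ M 3 3) ⟨
    N ^ (6 * M)                                        ∎
  exponents : n < N → Dec (N ≤ 6 * M) → N ≤ 6 * M
  exponents n<N (yes le) = le
  exponents n<N (no nle) = contradiction (powers n<N) (ℕₚ.<⇒≱ (ℕₚ.^-monoʳ-< N 2≤N (ℕₚ.≰⇒> nle)))
  by-cases : Dec (N ≤ n) → N ≤ 18 * n
  by-cases (yes N≤n) = ℕₚ.≤-trans N≤n (ℕₚ.m≤m+n n (17 * n))
  by-cases (no N≰n)  = begin
    N            ≤⟨ exponents (ℕₚ.≰⇒> N≰n) (N ℕ.≤? 6 * M) ⟩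
    6 * M        ≤⟨ ℕₚ.*-monoʳ-≤ 6 M≤3n ⟩
    6 * (3 * n)  ≡⟨ ℕₚ.*-assoc 6 3 n ⟨
    18 * n       ∎

-- The horizontal edges in rows 1, …, a and columns 0, …, a - 1 get the N = a² powers of N below N^N as
-- lengths, decreasing from row to row; row 0 copies row 1, and truncated subtraction gives length 1
-- where the exponent would become negative.
module Digits (q a : ℕ) (2≤a : 2 ≤ a) (2a≤q : a + a ≤ q) where

  N : ℕ
  N = a * a

  2≤N : 2 ≤ N
  2≤N = ℕₚ.≤-trans (s≤s (s≤s z≤n)) (ℕₚ.*-mono-≤ 2≤a 2≤a)

  instance
    N-nonZero : ℕ.NonZero N
    N-nonZero = ℕ.>-nonZero (ℕₚ.<⇒≤ 2≤N)

  h : ℕ → ℕ → ℕ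
  h r c = N ^ (N ∸ suc (a * pred r + c))

  -- A row has `q` edges of length at most `N ^ N`, so no prefix exceeds `v`.
  v : ℕ
  v = q * N ^ N

  open GridMetric q h v
  open Terminals q a

  h-antitone : ∀ {r r′} c → r ≤ r′ → h r′ c ≤ h r c
  h-antitone c r≤r′ = ℕₚ.^-monoʳ-≤ N (ℕₚ.∸-monoʳ-≤ N
    (s≤s (ℕₚ.+-monoˡ-≤ c (ℕₚ.*-monoʳ-≤ a (ℕₚ.pred-mono-≤ r≤r′)))))

  prefix-≤ : ∀ r c → prefix r c ≤ c * N ^ N
  prefix-≤ r zero    = z≤n
  prefix-≤ r (suc c) = ℕₚ.≤-trans (ℕₚ.+-mono-≤ (prefix-≤ r c) (ℕₚ.^-monoʳ-≤ N (ℕₚ.m∸n≤m N (suc (a * pred r + c)))))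
    (ℕₚ.≤-reflexive (ℕₚ.+-comm _ (N ^ N)))

  prefix-≤v : ∀ r c → c ≤ q → prefix r c ≤ v
  prefix-≤v r c c≤q = ℕₚ.≤-trans (prefix-≤ r c) (ℕₚ.*-monoˡ-≤ (N ^ N) c≤q)

  d : ℕ → ℕ → ℕ
  d r c = prefix r c + r * v

  terminal-dist : ∀ r c → 1 ≤ r → r ≤ a → c ≤ a →
    ∃ λ s → ∃ λ t → IsDist grid (terminal s) (terminal t) (ℕ→ℚ (d r c))
  terminal-dist r c 1≤r r≤a c≤a = join (row 2a≤q r 1≤r r≤a) (column 2a≤q c c≤a)
    where
    join : (∃ λ s → ∃ λ r′ → terminal s ≡ (r′ , zero) × toℕ r′ ≡ r) →
      (∃ λ t → ∃ λ c′ → terminal t ≡ (zero , c′) × toℕ c′ ≡ c) →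
      ∃ λ s → ∃ λ t → IsDist grid (terminal s) (terminal t) (ℕ→ℚ (d r c))
    join (s , r′ , es , refl) (t , c′ , et , refl) = s , t ,
      subst₂ (λ x y → IsDist grid x y (ℕ→ℚ (d (toℕ r′) (toℕ c′)))) (sym es) (sym et) (grid-dist h-antitone prefix-≤v r′ c′)

  rowOf colOf : Fin N → ℕ
  rowOf p = suc (toℕ (proj₁ (remQuot {a} a p)))
  colOf p = toℕ (proj₂ (remQuot {a} a p))

  d-digit : ∀ p → d (rowOf p) (suc (colOf p)) ≡ place N p + d (rowOf p) (colOf p)
  d-digit p = begin
    (prefix (rowOf p) (colOf p) + h (rowOf p) (colOf p)) + rowOf p * v
      ≡⟨ cong (_+ rowOf p * v) (ℕₚ.+-comm (prefix (rowOf p) (colOf p)) _) ⟩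
    (h (rowOf p) (colOf p) + prefix (rowOf p) (colOf p)) + rowOf p * v
      ≡⟨ ℕₚ.+-assoc (h (rowOf p) (colOf p)) _ _ ⟩
    h (rowOf p) (colOf p) + d (rowOf p) (colOf p)
      ≡⟨ cong (λ x → N ^ (N ∸ suc x) + d (rowOf p) (colOf p)) index ⟩
    place N p + d (rowOf p) (colOf p) ∎
    where
    open ≡-Reasoning
    -- `rowOf` is shifted by one because row 0 carries no digits, and the `pred` in `h` undoes the
    -- shift.
    index : a * toℕ (proj₁ (remQuot {a} a p)) + colOf p ≡ toℕ p
    index = trans (sym (Finₚ.toℕ-combine (proj₁ (remQuot {a} a p)) (proj₂ (remQuot {a} a p))))
      (cong toℕ (Finₚ.combine-remQuot {a} a p))

  module _ {n : ℕ} (H : Graph (Fin n)) (ι : Fin (suc q) → Fin n) (nonNeg : NonNeg H) (planar : Planar H)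
           (same : ∀ i j → SameDist grid (terminal i) (terminal j) H (ι i) (ι j)) where

    digits-≤ : ∃ λ M → M ≤ 3 * n × N ^ N ≤ suc (N * (N * n)) ^ M * suc (N * (N * n)) ^ M
    digits-≤ = m K , m≤3n ,
      distance-digits-≤ K nonNegK N (λ p → d (rowOf p) (suc (colOf p))) (λ p → d (rowOf p) (colOf p)) d-digit
        (λ p → in-K (rowOf p) (suc (colOf p)) (s≤s z≤n) (Finₚ.toℕ<n (proj₁ (remQuot {a} a p))) (Finₚ.toℕ<n (proj₂ (remQuot {a} a p))))
        (λ p → in-K (rowOf p) (colOf p) (s≤s z≤n) (Finₚ.toℕ<n (proj₁ (remQuot {a} a p))) (ℕₚ.<⇒≤ (Finₚ.toℕ<n (proj₂ (remQuot {a} a p)))))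
      where
      sparse = planar-sparsify H nonNeg planar
      K : Graph (Fin n)
      K = proj₁ sparse
      m≤3n : m K ≤ 3 * n
      m≤3n = proj₁ (proj₂ sparse)
      nonNegK : NonNeg K
      nonNegK = proj₁ (proj₂ (proj₂ sparse))
      in-K : ∀ r c → 1 ≤ r → r ≤ a → c ≤ a → ∃ λ x → ∃ λ y → IsDist K x y (ℕ→ℚ (d r c))
      in-K r c 1≤r r≤a c≤a = let s , t , δ = terminal-dist r c 1≤r r≤a c≤a in
        ι s , ι t , proj₂ (proj₂ (proj₂ sparse)) (proj₁ (same s t (ℕ→ℚ (d r c))) δ)

    N≤18n : N ≤ 18 * n
    N≤18n = digits⇒≤ 2≤N (proj₁ (proj₂ digits-≤)) (proj₂ (proj₂ digits-≤))

-- `162 = 9 * 18`: the digit count gives `a * a ≤ 18 * n`, and `k ≤ 3 * a`.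
ratio : ℚ
ratio = ℤ.+ 1 ℚ./ 162

ratio-≤ : ∀ x n → x ≤ 162 * n → (ratio *ℚ ℕ→ℚ x) ≤ℚ ℕ→ℚ n
ratio-≤ x n x≤162n = ℚₚ.toℚᵘ-cancel-≤ (begin
  ℚ.toℚᵘ (ratio *ℚ ℕ→ℚ x)            ≃⟨ ℚₚ.toℚᵘ-homo-* ratio (ℕ→ℚ x) ⟩
  ℚ.toℚᵘ ratio ℚᵘ.* ℚ.toℚᵘ (ℕ→ℚ x)   ≃⟨ ℚᵘₚ.*-cong (ℚᵘₚ.≃-refl {ℚ.toℚᵘ ratio}) (toℚᵘ-ℕ→ℚ x) ⟩
  mkℚᵘ (ℤ.+ 1) 161 ℚᵘ.* mkℚᵘ (ℤ.+ x) 0   ≤⟨ *≤* cross ⟩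
  mkℚᵘ (ℤ.+ n) 0                       ≃⟨ toℚᵘ-ℕ→ℚ n ⟨
  ℚ.toℚᵘ (ℕ→ℚ n)                     ∎)
  where
  open ℚᵘₚ.≤-Reasoning
  cross : (ℤ.+ 1 ℤ.* ℤ.+ x) ℤ.* ℤ.+ 1 ℤ.≤ ℤ.+ n ℤ.* ℤ.+ 162
  cross = subst₂ ℤ._≤_ (sym (trans (ℤₚ.*-identityʳ _) (ℤₚ.*-identityˡ (ℤ.+ x)))) (ℤₚ.pos-* n 162)
    (ℤ.+≤+ (subst (x ≤_) (ℕₚ.*-comm 162 n) x≤162n))

Incompressible : ℕ → Set
Incompressible k =
  Σ (Graph (Fin k × Fin k)) λ G → IsGrid k G × NonNeg G × Planar G
  × Σ (Fin k → Fin k × Fin k) λ τ → Injective _≡_ _≡_ τ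
  × (∀ (n : ℕ) (H : Graph (Fin n)) (ι : Fin k → Fin n) → Injective _≡_ _≡_ ι
      → NonNeg H → Planar H
      → (∀ i j → SameDist G (τ i) (τ j) H (ι i) (ι j))
      → (ratio *ℚ ℕ→ℚ (k * k)) ≤ℚ ℕ→ℚ n)

-- For such `k` the half `a` of `q` is below 2 and `a * a` is no base for digits. Injectivity of `ι`
-- gives `k ≤ n`, and `k * k ≤ 4 * n` suffices.
small-incompressible : ∀ q → suc q ≤ 4 → Incompressible (suc q)
small-incompressible q k≤4 = grid , grid-IsGrid , grid-NonNeg , grid-planar q ℓ , terminal , terminal-injective ,
  λ n H ι ι-injective _ _ _ → ratio-≤ (suc q * suc q) n
    (ℕₚ.≤-trans (ℕₚ.*-mono-≤ k≤4 (Finₚ.injective⇒≤ ι-injective)) (ℕₚ.*-monoˡ-≤ n (ℕₚ.m≤m+n 4 158)))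
  where
  open GridMetric q (λ _ _ → 0) 0
  -- With `a = q` all terminals lie in the top row; any injective choice would do.
  open Terminals q q

large-incompressible : ∀ q a → 2 ≤ a → a + a ≤ q → suc q ≤ 3 * a → Incompressible (suc q)
large-incompressible q a 2≤a 2a≤q k≤3a =
  grid , grid-IsGrid , grid-NonNeg , grid-planar q ℓ , terminal , terminal-injective ,
  λ n H ι _ nonNeg planar same → ratio-≤ (suc q * suc q) n (begin
    suc q * suc q      ≤⟨ ℕₚ.*-mono-≤ k≤3a k≤3a ⟩
    (3 * a) * (3 * a)  ≡⟨ solve 1 (λ x → (con 3 :* x) :* (con 3 :* x) := con 9 :* (x :* x)) refl a ⟩
    9 * (a * a)        ≤⟨ ℕₚ.*-monoʳ-≤ 9 (N≤18n H ι nonNeg planar same) ⟩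
    9 * (18 * n)       ≡⟨ ℕₚ.*-assoc 9 18 n ⟨
    162 * n            ∎)
  where
  open Digits q a 2≤a 2a≤q
  open GridMetric q h v
  open Terminals q a
  open ℕₚ.≤-Reasoning
  open +-*-Solver

incompressible : ∀ k → 1 ≤ k → Incompressible k
incompressible (suc q) _ = by-cases (2 ℕ.≤? a)
  where
  a : ℕ
  a = q / 2
  q≡r+2a : q ≡ q % 2 + (a + a)
  q≡r+2a = trans (DivMod.m≡m%n+[m/n]*n q 2)
    (cong (q % 2 +_) (trans (ℕₚ.*-comm a 2) (cong (a +_) (ℕₚ.+-identityʳ a))))
  2a≤q : a + a ≤ q
  2a≤q = subst (a + a ≤_) (sym q≡r+2a) (ℕₚ.m≤n+m (a + a) (q % 2))
  k≤2+2a : suc q ≤ 2 + (a + a)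
  k≤2+2a = subst (λ x → suc x ≤ 2 + (a + a)) (sym q≡r+2a) (ℕₚ.+-monoˡ-≤ (a + a) (DivMod.m%n<n q 2))
  by-cases : Dec (2 ≤ a) → Incompressible (suc q)
  by-cases (yes 2≤a) = large-incompressible q a 2≤a 2a≤q (ℕₚ.≤-trans k≤2+2a
    (ℕₚ.≤-trans (ℕₚ.+-monoˡ-≤ (a + a) 2≤a)
      (ℕₚ.≤-reflexive (cong (λ x → a + (a + x)) (sym (ℕₚ.+-identityʳ a))))))
  by-cases (no 2≰a)  = small-incompressible q (ℕₚ.≤-trans k≤2+2a
    (ℕₚ.+-monoʳ-≤ 2 (ℕₚ.+-mono-≤ (ℕ.s≤s⁻¹ (ℕₚ.≰⇒> 2≰a)) (ℕ.s≤s⁻¹ (ℕₚ.≰⇒> 2≰a)))))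

theorem6 : Σ ℚ λ c → 0ℚ <ℚ c
    × (∀ (k : ℕ) → 1 ≤ k →
    Σ (Graph (Fin k × Fin k)) λ G → IsGrid k G × NonNeg G × Planar G
    × Σ (Fin k → Fin k × Fin k) λ τ → Injective _≡_ _≡_ τ
    × (∀ (n : ℕ) (H : Graph (Fin n)) (ι : Fin k → Fin n) → Injective _≡_ _≡_ ι
    → NonNeg H → Planar H
    → (∀ i j → SameDist G (τ i) (τ j) H (ι i) (ι j))
    → (c *ℚ ℕ→ℚ (k * k)) ≤ℚ ℕ→ℚ n))
theorem6 = ratio , toWitness {a? = 0ℚ ℚₚ.<? ratio} _ , incompressible
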